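{- There exists a $2$-$(8,4,\lambda)_2$ design for every $\lambda\in\{63,84,147,168,189,252,273,294\}$, and there exists a $2$-$(10,4,\lambda)_2$ design for every $\lambda\in\{1785,1870,3570,3655,5355\}$.
   Context: For a $v$-dimensional vector space $V$ over the finite field $\mathrm{GF}(q)$, a pair $(V,\mathcal{B})$ with $\mathcal{B}$ a set of $k$-dimensional subspaces of $V$ (called blocks) is a $t$-$(v,k,\lambda)_q$ (subspace) design if every $t$-dimensional subspace of $V$ is contained in exactly $\lambda$ elements of $\mathcal{B}$. Here $q=2$. -}

module Defs where

open import Algebra.Bundles using (CommutativeRing)
open import Algebra.Module.Bundles using (LeftModule)
import Algebra.Definitions.RawMonoid as RawMonoidDefinitions
open import Data.Bool.Properties using (xor-∧-commutativeRing)
open import Data.Fin.Base using (Fin)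
open import Data.Nat.Base using (ℕ)
open import Data.Product.Base using (Σ; ∃; _×_; proj₁)
open import Data.Unit.Base using (tt)
open import Data.Vec.Functional using (Vector)
open import Function.Bundles using (Inverse)
open import Level using (0ℓ; suc)
open import Relation.Binary.Bundles using (Setoid)
import Relation.Binary.Construct.On as On
import Relation.Binary.PropositionalEquality as ≡
open import Relation.Unary using (Pred; _∈_; _⊆_; _≐_; U)
open import Relation.Unary.Relation.Binary.Equality using (≐-setoid)

GF2 : CommutativeRing 0ℓ 0ℓ
GF2 = xor-∧-commutativeRing

module GF2 = CommutativeRing GF2

VectorSpace : Set₁
VectorSpace = LeftModule GF2.ring 0ℓ 0ℓ

module Subspaces (V : VectorSpace) where

  open LeftModule V
  open RawMonoidDefinitions +ᴹ-rawMonoid using (sum)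

  linearCombination : ∀ {n} → Vector GF2.Carrier n → Vector Carrierᴹ n → Carrierᴹ
  linearCombination c b = sum (λ i → c i *ₗ b i)

  LinearlyIndependent : ∀ {n} → Vector Carrierᴹ n → Set
  LinearlyIndependent b =
    ∀ c → linearCombination c b ≈ᴹ 0ᴹ → ∀ i → c i GF2.≈ GF2.0#

  record Subspace : Set₁ where
    field
      carrier   : Pred Carrierᴹ 0ℓ
      resp-≈    : ∀ {x y} → x ≈ᴹ y → x ∈ carrier → y ∈ carrier
      0-closed  : 0ᴹ ∈ carrier
      +-closed  : ∀ {x y} → x ∈ carrier → y ∈ carrier → x +ᴹ y ∈ carrier
      *ₗ-closed : ∀ a {x} → x ∈ carrier → a *ₗ x ∈ carrier

  open Subspace public using (carrier)

  whole : Subspace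
  whole = record
    { carrier   = U
    ; resp-≈    = λ _ _ → tt
    ; 0-closed  = tt
    ; +-closed  = λ _ _ → tt
    ; *ₗ-closed = λ _ _ → tt
    }

  record IsBasis (W : Subspace) {n : ℕ} (b : Vector Carrierᴹ n) : Set where
    field
      member      : ∀ i → b i ∈ carrier W
      independent : LinearlyIndependent b
      spanning    : ∀ {x} → x ∈ carrier W → ∃ λ c → linearCombination c b ≈ᴹ x

  HasDimension : Subspace → ℕ → Set
  HasDimension W n = ∃ λ (b : Vector Carrierᴹ n) → IsBasis W b

  -- Members of a family ℬ that contain T.  Two of them are identified when
  -- they have the same vectors, so that counting up to this equality counts
  -- subspaces, not their presentations or membership proofs.
  containing : Pred Subspace 0ℓ → Subspace → Setoid (suc 0ℓ) 0ℓ
  containing ℬ T = On.setoid (≐-setoid Carrierᴹ 0ℓ) f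
    where
    f : (Σ Subspace λ W → W ∈ ℬ × carrier T ⊆ carrier W) → Pred Carrierᴹ 0ℓ
    f p = carrier (proj₁ p)

HasCardinality : ∀ {a ℓ} → Setoid a ℓ → ℕ → Set _
HasCardinality S n = Inverse S (≡.setoid (Fin n))

-- A t-(v,k,l)₂ design; l is the usual λ, which is reserved in Agda.
record SubspaceDesign (t v k l : ℕ) : Set₁ where
  field
    V : VectorSpace

  open Subspaces V

  field
    V-dimension     : HasDimension whole v
    Block           : Pred Subspace 0ℓ
    Block-resp-≐    : ∀ {W W′} → carrier W ≐ carrier W′ → W ∈ Block → W′ ∈ Block
    Block-dimension : ∀ {W} → W ∈ Block → HasDimension W k
    balanced        : ∀ T → HasDimension T t → HasCardinality (containing Block T) l

module Submission where

-- Write GF(2)^v as GF(2) × U with U = GF(2^(v-1)).  A 4-space not contained in U is determined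
-- by its intersection with U, a 3-space s, and a coset of s in U.  Hence, if D₃ is a
-- 2-(v-1,3,c)₂ design and D₄ is a 2-(v-1,4,l₄)₂ design, then the 4-spaces of U in D₄ together
-- with the 4-spaces that meet U in a member of D₃ cover each 2-space of U exactly
-- l₄ + 2^(v-4) c times, and any other 2-space as often as D₃ covers a point, which is
-- c (2^(v-2) - 1) / 3 times.  The two numbers agree for l₄ = 5 c (v = 8) and for l₄ = 21 c (v = 10).
-- The designs D₃ and D₄ are unions of orbits of the multiplicative group of U, extended for
-- v = 10 by Frobenius automorphisms, so that only the members through 1 ∈ U have
-- to be enumerated.

open import Defs
open import Algebra.Bundles using (AbelianGroup)
import Algebra.Properties.CommutativeSemigroup as CommutativeSemigroupProperties
open import Algebra.Structures using (IsAbelianGroup)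
open import Data.Bool.Base using (Bool; true; false; _xor_; _∧_; _∨_; not; if_then_else_; T)
open import Data.Bool.ListAction using (all; any)
import Data.Bool.Properties as Bool
open import Data.Fin.Base as Fin using (Fin; zero; suc)
open import Data.List.Base as List using (List; []; _∷_; _++_; map; foldr; length; cartesianProductWith; concatMap; filter; upTo; null)
open import Data.List.Membership.Propositional using (_∈_; find; lose)
open import Data.List.Membership.Propositional.Properties
open import Data.List.Membership.Propositional.Properties.WithK using (unique⇒irrelevant)
import Data.List.Properties as List
import Data.List.Relation.Unary.All as All
import Data.List.Relation.Unary.All.Properties as All
open import Data.List.Relation.Unary.All using ([]; _∷_)
open import Data.List.Relation.Unary.AllPairs using ([]; _∷_)
open import Data.List.Relation.Unary.Any using (here; there; index)
import Data.List.Relation.Unary.Any.Properties as Any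
open import Data.List.Relation.Unary.Unique.Propositional using (Unique)
import Data.List.Relation.Unary.Unique.Propositional.Properties as Unique
open import Data.Nat.Base using (ℕ; zero; suc; _+_; _*_; _∸_; _^_; _<_; _≤_; _<ᵇ_; _≡ᵇ_; s≤s)
open import Data.Nat.DivMod using (_%_; _/_; m≡m%n+[m/n]*n; m%n<n; m<n⇒m%n≡m)
import Data.Nat.Properties as ℕ
open import Data.Nat.Tactic.RingSolver using (solve-∀)
open import Data.Product.Base as Prod using (Σ; ∃; _×_; _,_; proj₁; proj₂)
open import Data.Sum.Base as Sum using (_⊎_; inj₁; inj₂; [_,_]′)
open import Data.Unit.Base using (⊤; tt)
open import Data.Vec.Base as Vec using (Vec; []; _∷_; zipWith; replicate)
import Data.Vec.Functional as Vector
import Data.Vec.Properties as Vec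
open import Function.Base using (_∘_; id; _$_)
open import Function.Bundles using (_⇔_; mk⇔; Equivalence)
open import Level using (0ℓ)
open import Relation.Binary.PropositionalEquality hiding (J)
open import Relation.Nullary using (¬_; contradiction; yes; no)
open import Relation.Nullary.Decidable using (T?)
open import Relation.Unary using (Pred)

open Equivalence using (to; from)

-- The second count is the number of members of D₃ through a point: the point lies on 2^(v-2) - 1
-- lines of U, each line lies in c members, and a member through the point contains 3 of these
-- lines. A 2-space outside U meets U in one point, and each 3-space through that point has exactly
-- one coset that completes it to a block containing the 2-space. Both counts are 21 c for v = 8 and
-- 85 c for v = 10, whence c in {3, 4, 7, 8, 9, 12, 13, 14} and c in {21, 22, 42, 43, 63}. The
-- defining counts of D₃ and D₄ are established by evaluation, and keeping that evaluation small
-- shapes the proof. Subspaces are echelon forms, so that equal sets of vectors are equal data. Of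
-- the field multiplication only the linear map α and its powers occur, with natural numbers as
-- exponents. A group element moves every line to one through 1 and a member of a short list, so
-- that finitely many counts decide the design property.

private variable
  m n c d k l : ℕ
  A : Set

-- Vectors over GF(2)

V : ℕ → Set
V = Vec Bool

infixr 6 _⊕_
_⊕_ : V n → V n → V n
_⊕_ = zipWith _xor_

𝟘 : V n
𝟘 = replicate _ false

infixr 7 _·_
_·_ : Bool → V n → V n
true  · x = x
false · x = 𝟘

⊕-self : (x : V n) → x ⊕ x ≡ 𝟘
⊕-self []      = refl
⊕-self (b ∷ x) = cong₂ _∷_ (Bool.xor-same b) (⊕-self x)

⊕-isAbelianGroup : IsAbelianGroup _≡_ (_⊕_ {n}) 𝟘 id
⊕-isAbelianGroup = record
  { isGroup = record
    { isMonoid = record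
      { isSemigroup = record
        { isMagma = record { isEquivalence = isEquivalence ; ∙-cong = cong₂ _⊕_ }
        ; assoc = Vec.zipWith-assoc Bool.xor-assoc
        }
      ; identity = Vec.zipWith-identityˡ Bool.xor-identityˡ , Vec.zipWith-identityʳ Bool.xor-identityʳ
      }
    ; inverse = ⊕-self , ⊕-self
    ; ⁻¹-cong = id
    }
  ; comm = Vec.zipWith-comm Bool.xor-comm
  }

⊕-abelianGroup : ℕ → AbelianGroup _ _
⊕-abelianGroup n = record { isAbelianGroup = ⊕-isAbelianGroup {n} }

module _ {n : ℕ} where
  open AbelianGroup (⊕-abelianGroup n) public using ()
    renaming (assoc to ⊕-assoc; comm to ⊕-comm; identityˡ to ⊕-identityˡ; identityʳ to ⊕-identityʳ)
  open CommutativeSemigroupProperties (AbelianGroup.commutativeSemigroup (⊕-abelianGroup n)) public using ()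
    renaming (interchange to ⊕-interchange)

⊕-cancel : (x y : V n) → x ⊕ (x ⊕ y) ≡ y
⊕-cancel x y = trans (sym (⊕-assoc x x y)) (trans (cong (_⊕ y) (⊕-self x)) (⊕-identityˡ y))

⊕≡𝟘⇒≡ : (x y : V n) → x ⊕ y ≡ 𝟘 → x ≡ y
⊕≡𝟘⇒≡ x y eq = trans (sym (⊕-identityʳ x)) (trans (cong (x ⊕_) (sym eq)) (⊕-cancel x y))

xor-· : (a b : Bool) (x : V n) → (a xor b) · x ≡ a · x ⊕ b · x
xor-· true  true  x = sym (⊕-self x)
xor-· true  false x = sym (⊕-identityʳ x)
xor-· false b     x = sym (⊕-identityˡ (b · x))

·-⊕ : (a : Bool) (x y : V n) → a · (x ⊕ y) ≡ a · x ⊕ a · y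
·-⊕ true  x y = refl
·-⊕ false x y = sym (⊕-identityˡ 𝟘)

Linear : (V m → V n) → Set
Linear f = ∀ x y → f (x ⊕ y) ≡ f x ⊕ f y

linear-𝟘 : {f : V m → V n} → Linear f → f 𝟘 ≡ 𝟘
linear-𝟘 {f = f} lin = begin
  f 𝟘            ≡⟨ cong f (⊕-self 𝟘) ⟨
  f (𝟘 ⊕ 𝟘)      ≡⟨ lin 𝟘 𝟘 ⟩
  f 𝟘 ⊕ f 𝟘      ≡⟨ ⊕-self (f 𝟘) ⟩
  𝟘              ∎
  where open ≡-Reasoning

module _ (n : ℕ) where
  vectorSpace : VectorSpace
  vectorSpace = record
    { Carrierᴹ = V n
    ; _≈ᴹ_ = _≡_
    ; _+ᴹ_ = _⊕_
    ; _*ₗ_ = _·_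
    ; 0ᴹ = 𝟘
    ; -ᴹ_ = id
    ; isLeftModule = record
      { isLeftSemimodule = record
        { +ᴹ-isCommutativeMonoid = IsAbelianGroup.isCommutativeMonoid ⊕-isAbelianGroup
        ; isPreleftSemimodule = record
          { *ₗ-cong = cong₂ _·_
          ; *ₗ-zeroˡ = λ _ → refl
          ; *ₗ-distribʳ = λ x a b → xor-· a b x
          ; *ₗ-identityˡ = λ _ → refl
          ; *ₗ-assoc = λ { true b x → refl ; false b x → refl }
          ; *ₗ-zeroʳ = λ { true → refl ; false → refl }
          ; *ₗ-distribˡ = ·-⊕
          }
        }
      ; -ᴹ‿cong = id
      ; -ᴹ‿inverse = ⊕-self , ⊕-self
      }
    }

-- Subspaces in echelon form

-- Subspaces of codimension c in reduced echelon form, described by the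
-- quotient map: `pivot v s` contains, over s, one more vector true ∷ x
-- where x is any vector with image v modulo s.
data Sub : ℕ → ℕ → Set where
  []    : Sub 0 0
  free  : Sub m c → Sub (suc m) (suc c)
  pivot : V c → Sub m c → Sub (suc m) c

proj : Sub m c → V m → V c
proj []          []          = []
proj (free s)    (h ∷ t)     = h ∷ proj s t
proj (pivot v s) (true ∷ t)  = v ⊕ proj s t
proj (pivot v s) (false ∷ t) = proj s t

infix 4 _∈ₛ_ _∈ₚ_ _∈⟨_⟩
_∈ₛ_ : V m → Sub m c → Set
x ∈ₛ s = proj s x ≡ 𝟘

proj-pivot : (v : V c) (s : Sub m c) (h : Bool) (t : V m) → proj (pivot v s) (h ∷ t) ≡ h · v ⊕ proj s t
proj-pivot v s true  t = refl
proj-pivot v s false t = sym (⊕-identityˡ _)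

proj-linear : (s : Sub m c) → Linear (proj s)
proj-linear []          []      []        = refl
proj-linear (free s)    (a ∷ x) (b ∷ y)   = cong ((a xor b) ∷_) (proj-linear s x y)
proj-linear (pivot v s) (a ∷ x) (b ∷ y)   = begin
  proj (pivot v s) ((a xor b) ∷ (x ⊕ y))             ≡⟨ proj-pivot v s (a xor b) (x ⊕ y) ⟩
  (a xor b) · v ⊕ proj s (x ⊕ y)                  ≡⟨ cong₂ _⊕_ (xor-· a b v) (proj-linear s x y) ⟩
  (a · v ⊕ b · v) ⊕ (proj s x ⊕ proj s y)         ≡⟨ ⊕-interchange (a · v) (b · v) (proj s x) (proj s y) ⟩
  (a · v ⊕ proj s x) ⊕ (b · v ⊕ proj s y)         ≡⟨ cong₂ _⊕_ (proj-pivot v s a x) (proj-pivot v s b y) ⟨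
  proj (pivot v s) (a ∷ x) ⊕ proj (pivot v s) (b ∷ y) ∎
  where open ≡-Reasoning

lift : Sub m c → V c → V m
lift []          []      = []
lift (free s)    (h ∷ t) = h ∷ lift s t
lift (pivot v s) t       = false ∷ lift s t

proj-lift : (s : Sub m c) (y : V c) → proj s (lift s y) ≡ y
proj-lift []          []      = refl
proj-lift (free s)    (h ∷ t) = cong (h ∷_) (proj-lift s t)
proj-lift (pivot v s) t       = proj-lift s t

∈ₛ-𝟘 : (s : Sub m c) → 𝟘 ∈ₛ s
∈ₛ-𝟘 s = linear-𝟘 (proj-linear s)

∈ₛ-⊕ : (s : Sub m c) {x y : V m} → x ∈ₛ s → y ∈ₛ s → x ⊕ y ∈ₛ s
∈ₛ-⊕ s {x} {y} p q = trans (proj-linear s x y) (trans (cong₂ _⊕_ p q) (⊕-self 𝟘))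

∈ₛ-cancel : (s : Sub m c) {x y : V m} → x ∈ₛ s → x ⊕ y ∈ₛ s → y ∈ₛ s
∈ₛ-cancel s {x} {y} p q = subst (_∈ₛ s) (⊕-cancel x y) (∈ₛ-⊕ s p q)

pivotVector : V c → Sub m c → V (suc m)
pivotVector v s = true ∷ lift s v

pivot-∈ : (v : V c) (s : Sub m c) → pivotVector v s ∈ₛ pivot v s
pivot-∈ v s = trans (cong (v ⊕_) (proj-lift s v)) (⊕-self v)

Space : ℕ → Set
Space n = Σ ℕ (Sub n)

_∈ₚ_ : V n → Space n → Set
x ∈ₚ s = x ∈ₛ proj₂ s

-- Reduced echelon forms are canonical: a vector with leading `true` separates `pivot` from `free`,
-- and two pivot entries agree because `pivotVector v s` lies in both spaces. The codimensions may
-- differ at the outset, since a computed span does not show its codimension in its type.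
≡-by-members : (s : Sub m c) (s′ : Sub m d) → (∀ x → x ∈ₛ s → x ∈ₛ s′) → (∀ x → x ∈ₛ s′ → x ∈ₛ s) →
               _≡_ {A = Space m} (c , s) (d , s′)
≡-by-members [] [] _ _ = refl
≡-by-members (free s) (free s′) f g
  with refl ← ≡-by-members s s′ (λ x p → cong Vec.tail (f (false ∷ x) (cong (false ∷_) p)))
                                (λ x p → cong Vec.tail (g (false ∷ x) (cong (false ∷_) p))) = refl
≡-by-members (free s) (pivot v s′) f g = contradiction (cong Vec.head (g (pivotVector v s′) (pivot-∈ v s′))) (λ ())
≡-by-members (pivot v s) (free s′) f g = contradiction (cong Vec.head (f (pivotVector v s) (pivot-∈ v s))) (λ ())
≡-by-members (pivot v s) (pivot v′ s′) f g
  with refl ← ≡-by-members s s′ (λ x → f (false ∷ x)) (λ x → g (false ∷ x))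
  with refl ← ⊕≡𝟘⇒≡ v′ v (trans (cong (v′ ⊕_) (sym (proj-lift s v))) (f (pivotVector v s) (pivot-∈ v s))) = refl

≡-by-members′ : (s s′ : Sub m c) → (∀ x → x ∈ₛ s ⇔ x ∈ₛ s′) → s ≡ s′
≡-by-members′ s s′ e with refl ← ≡-by-members s s′ (λ x → to (e x)) (λ x → from (e x)) = refl

-- The preimage of the second space under the quotient map by the first.
comp : Sub m c → Sub c d → Sub m d
comp []          r           = r
comp (free s)    (free r)    = free (comp s r)
comp (free s)    (pivot v r) = pivot v (comp s r)
comp (pivot v s) r           = pivot (proj r v) (comp s r)

proj-comp : (s : Sub m c) (r : Sub c d) (x : V m) → proj (comp s r) x ≡ proj r (proj s x)
proj-comp []          []          []          = refl
proj-comp (free s)    (free r)    (h ∷ t)     = cong (h ∷_) (proj-comp s r t)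
proj-comp (free s)    (pivot v r) (true ∷ t)  = cong (v ⊕_) (proj-comp s r t)
proj-comp (free s)    (pivot v r) (false ∷ t) = proj-comp s r t
proj-comp (pivot v s) r           (true ∷ t)  =
  trans (cong (proj r v ⊕_) (proj-comp s r t)) (sym (proj-linear r v (proj s t)))
proj-comp (pivot v s) r           (false ∷ t) = proj-comp s r t

comp-⊇ : (s : Sub m c) (r : Sub c d) {x : V m} → x ∈ₛ s → x ∈ₛ comp s r
comp-⊇ s r {x} p = trans (proj-comp s r x) (trans (cong (proj r) p) (∈ₛ-𝟘 r))

comp-injective : (s : Sub m c) {r r′ : Sub c d} → comp s r ≡ comp s r′ → r ≡ r′
comp-injective s {r} {r′} eq = ≡-by-members′ r r′ λ y → mk⇔ (half r r′ eq y) (half r′ r (sym eq) y)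
  where
  half : ∀ r r′ → comp s r ≡ comp s r′ → ∀ y → y ∈ₛ r → y ∈ₛ r′
  half r r′ eq y p = begin
    proj r′ y                     ≡⟨ cong (proj r′) (proj-lift s y) ⟨
    proj r′ (proj s (lift s y))   ≡⟨ proj-comp s r′ (lift s y) ⟨
    proj (comp s r′) (lift s y)   ≡⟨ cong (λ w → proj w (lift s y)) eq ⟨
    proj (comp s r) (lift s y)    ≡⟨ proj-comp s r (lift s y) ⟩
    proj r (proj s (lift s y))    ≡⟨ cong (proj r) (proj-lift s y) ⟩
    proj r y                      ≡⟨ p ⟩
    𝟘                             ∎
    where open ≡-Reasoning

-- The correspondence theorem: with `comp-injective`, the spaces of codimension `d` above `s` are in
-- bijection with `Sub c d`, and can be enumerated without repetition.
factor : (s : Sub m c) (w : Sub m d) → (∀ x → x ∈ₛ s → x ∈ₛ w) → ∃ λ (r : Sub c d) → comp s r ≡ w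
factor []          []          f = [] , refl
factor (free s)    (free w)    f = Prod.map free (cong free)
  (factor s w λ x p → cong Vec.tail (f (false ∷ x) (cong (false ∷_) p)))
factor (free s)    (pivot v w) f = Prod.map (pivot v) (cong (pivot v))
  (factor s w λ x p → f (false ∷ x) (cong (false ∷_) p))
factor (pivot v s) (free w)    f = contradiction (cong Vec.head (f (pivotVector v s) (pivot-∈ v s))) (λ ())
factor (pivot v s) (pivot u w) f with r , refl ← factor s w (λ x → f (false ∷ x)) =
  r , cong (λ y → pivot y (comp s r)) (sym (⊕≡𝟘⇒≡ u (proj r v) (trans (cong (u ⊕_) eq) (f (pivotVector v s) (pivot-∈ v s)))))
  where
  eq : proj r v ≡ proj (comp s r) (lift s v)
  eq = sym (trans (proj-comp s r (lift s v)) (cong (proj r) (proj-lift s v)))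

zeroSub : ∀ n → Sub n n
zeroSub zero    = []
zeroSub (suc n) = free (zeroSub n)

proj-zeroSub : (x : V n) → proj (zeroSub n) x ≡ x
proj-zeroSub []      = refl
proj-zeroSub (h ∷ t) = cong (h ∷_) (proj-zeroSub t)

freeₚ : Space n → Space (suc n)
freeₚ (c , s) = suc c , free s

-- At `𝟘` this is the zero space, so that `add` also covers a vector already in the space.
line : V n → Space n
line []          = 0 , []
line (true ∷ t)  = _ , pivot t (zeroSub _)
line (false ∷ t) = freeₚ (line t)

∈-line⁻ : (y x : V n) → x ∈ₚ line y → x ≡ 𝟘 ⊎ x ≡ y
∈-line⁻ []          []          p = inj₁ refl
∈-line⁻ (true ∷ y)  (true ∷ x)  p = inj₂ (cong (true ∷_)
  (sym (⊕≡𝟘⇒≡ y x (trans (cong (y ⊕_) (sym (proj-zeroSub x))) p))))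
∈-line⁻ (true ∷ y)  (false ∷ x) p = inj₁ (cong (false ∷_) (trans (sym (proj-zeroSub x)) p))
∈-line⁻ (false ∷ y) (h ∷ x)     p with refl ← cong Vec.head p =
  Sum.map (cong (false ∷_)) (cong (false ∷_)) (∈-line⁻ y x (cong Vec.tail p))

line-∈ : (y : V n) → y ∈ₚ line y
line-∈ []          = refl
line-∈ (true ∷ y)  = trans (cong (y ⊕_) (proj-zeroSub y)) (⊕-self y)
line-∈ (false ∷ y) = cong (false ∷_) (line-∈ y)

codim-line : (y : V n) → y ≢ 𝟘 → suc (proj₁ (line y)) ≡ n
codim-line []          ne = contradiction refl ne
codim-line (true ∷ y)  ne = refl
codim-line (false ∷ y) ne = cong suc (codim-line y (ne ∘ cong (false ∷_)))

codim-line-𝟘 : ∀ n → proj₁ (line (𝟘 {n})) ≡ n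
codim-line-𝟘 zero    = refl
codim-line-𝟘 (suc n) = cong suc (codim-line-𝟘 n)

add : V n → Space n → Space n
add x (_ , s) = Prod.map id (comp s) (line (proj s x))

∈-add⁻ : (b : V n) (s : Space n) {x : V n} → x ∈ₚ add b s → x ∈ₚ s ⊎ b ⊕ x ∈ₚ s
∈-add⁻ b (_ , s) {x} p = Sum.map id
  (λ eq → trans (proj-linear s b x) (trans (cong (proj s b ⊕_) eq) (⊕-self (proj s b))))
  (∈-line⁻ (proj s b) (proj s x) (trans (sym (proj-comp s _ x)) p))

∈-add⁺ : (b : V n) (s : Space n) {x : V n} → x ∈ₚ s ⊎ b ⊕ x ∈ₚ s → x ∈ₚ add b s
∈-add⁺ b (_ , s)     (inj₁ p) = comp-⊇ s _ p
∈-add⁺ b (_ , s) {x} (inj₂ p) = trans (proj-comp s _ x)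
  (trans (cong (proj (proj₂ (line (proj s b))))
               (sym (⊕≡𝟘⇒≡ (proj s b) (proj s x) (trans (sym (proj-linear s b x)) p))))
         (line-∈ (proj s b)))

span : List (V n) → Space n
span = foldr add (_ , zeroSub _)

-- A coefficient in GF(2) only decides whether a generator is subtracted. In this form spans pass
-- through linear maps by induction on the list.
_∈⟨_⟩ : V n → List (V n) → Set
x ∈⟨ [] ⟩     = x ≡ 𝟘
x ∈⟨ b ∷ bs ⟩ = x ∈⟨ bs ⟩ ⊎ b ⊕ x ∈⟨ bs ⟩

∈-span : (bs : List (V n)) {x : V n} → x ∈ₚ span bs ⇔ x ∈⟨ bs ⟩
∈-span []       {x} = mk⇔ (trans (sym (proj-zeroSub x))) (trans (proj-zeroSub x))
∈-span (b ∷ bs) = mk⇔ (Sum.map (to (∈-span bs)) (to (∈-span bs)) ∘ ∈-add⁻ b (span bs))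
                      (∈-add⁺ b (span bs) ∘ Sum.map (from (∈-span bs)) (from (∈-span bs)))

∈⟨⟩-𝟘 : (bs : List (V n)) → 𝟘 ∈⟨ bs ⟩
∈⟨⟩-𝟘 []       = refl
∈⟨⟩-𝟘 (b ∷ bs) = inj₁ (∈⟨⟩-𝟘 bs)

∈⇒∈⟨⟩ : {bs : List (V n)} {x : V n} → x ∈ bs → x ∈⟨ bs ⟩
∈⇒∈⟨⟩ {bs = b ∷ bs} (here refl) = inj₂ (subst (_∈⟨ bs ⟩) (sym (⊕-self b)) (∈⟨⟩-𝟘 bs))
∈⇒∈⟨⟩ {bs = b ∷ bs} (there p)   = inj₁ (∈⇒∈⟨⟩ p)

∈⟨⟩-⊆ : (s : Sub n c) {bs : List (V n)} → (∀ {b} → b ∈ bs → b ∈ₛ s) → ∀ {x} → x ∈⟨ bs ⟩ → x ∈ₛ s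
∈⟨⟩-⊆ s {[]}     f refl     = ∈ₛ-𝟘 s
∈⟨⟩-⊆ s {b ∷ bs} f (inj₁ p) = ∈⟨⟩-⊆ s (f ∘ there) p
∈⟨⟩-⊆ s {b ∷ bs} f (inj₂ p) = ∈ₛ-cancel s (f (here refl)) (∈⟨⟩-⊆ s (f ∘ there) p)

module _ {f : V m → V n} (lin : Linear f) where

  ∈⟨⟩-map⁺ : (bs : List (V m)) {x : V m} → x ∈⟨ bs ⟩ → f x ∈⟨ map f bs ⟩
  ∈⟨⟩-map⁺ []       refl     = linear-𝟘 lin
  ∈⟨⟩-map⁺ (b ∷ bs) (inj₁ p) = inj₁ (∈⟨⟩-map⁺ bs p)
  ∈⟨⟩-map⁺ (b ∷ bs) (inj₂ p) = inj₂ (subst (_∈⟨ map f bs ⟩) (lin b _) (∈⟨⟩-map⁺ bs p))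

  ∈⟨⟩-map⁻ : (bs : List (V m)) {y : V n} → y ∈⟨ map f bs ⟩ → ∃ λ x → x ∈⟨ bs ⟩ × f x ≡ y
  ∈⟨⟩-map⁻ []       refl = 𝟘 , refl , linear-𝟘 lin
  ∈⟨⟩-map⁻ (b ∷ bs) (inj₁ p) with x , q , eq ← ∈⟨⟩-map⁻ bs p = x , inj₁ q , eq
  ∈⟨⟩-map⁻ (b ∷ bs) {y} (inj₂ p) with x , q , eq ← ∈⟨⟩-map⁻ bs p =
    b ⊕ x , inj₂ (subst (_∈⟨ bs ⟩) (sym (⊕-cancel b x)) q) ,
    trans (lin b x) (trans (cong (f b ⊕_) eq) (⊕-cancel (f b) y))

codim-add-∈ : (b : V n) (s : Space n) → b ∈ₚ s → proj₁ (add b s) ≡ proj₁ s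
codim-add-∈ b (c , s) p = trans (cong (proj₁ ∘ line) p) (codim-line-𝟘 c)

codim-add-∉ : (b : V n) (s : Space n) → ¬ (b ∈ₚ s) → suc (proj₁ (add b s)) ≡ proj₁ s
codim-add-∉ b (c , s) p = codim-line (proj s b) p

basis : Sub m c → List (V m)
basis []          = []
basis (free s)    = map (false ∷_) (basis s)
basis (pivot v s) = pivotVector v s ∷ map (false ∷_) (basis s)

false∷-linear : Linear {m} (false ∷_)
false∷-linear x y = refl

∈-basis : (s : Sub m c) {x : V m} → x ∈ₛ s ⇔ x ∈⟨ basis s ⟩
∈-basis s = mk⇔ (complete s) (∈⟨⟩-⊆ s (sound s))
  where
  sound : (s : Sub m c) {x : V m} → x ∈ basis s → x ∈ₛ s
  sound (free s)    p with x , q , refl ← ∈-map⁻ (false ∷_) p = cong (false ∷_) (sound s q)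
  sound (pivot v s) (here refl) = pivot-∈ v s
  sound (pivot v s) (there p) with x , q , refl ← ∈-map⁻ (false ∷_) p = sound s q

  complete : (s : Sub m c) {x : V m} → x ∈ₛ s → x ∈⟨ basis s ⟩
  complete []          {[]}        p = refl
  complete (free s)    {h ∷ x}     p with refl ← cong Vec.head p =
    ∈⟨⟩-map⁺ false∷-linear (basis s) (complete s (cong Vec.tail p))
  complete (pivot v s) {false ∷ x} p = inj₁ (∈⟨⟩-map⁺ false∷-linear (basis s) (complete s p))
  complete (pivot v s) {true ∷ x}  p = inj₂ (∈⟨⟩-map⁺ false∷-linear (basis s) (complete s
    (trans (proj-linear s (lift s v) x) (trans (cong (_⊕ proj s x) (proj-lift s v)) p))))

length-basis : (s : Sub m c) → length (basis s) + c ≡ m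
length-basis []          = refl
length-basis (free {c = c} s)    = trans (cong (_+ suc c) (List.length-map (false ∷_) (basis s)))
  (trans (ℕ.+-suc _ c) (cong suc (length-basis s)))
length-basis (pivot {c = c} v s) = cong suc (trans (cong (_+ c) (List.length-map (false ∷_) (basis s))) (length-basis s))

Independent : List (V n) → Set
Independent []       = ⊤
Independent (b ∷ bs) = ¬ (b ∈⟨ bs ⟩) × Independent bs

independent-false∷ : {bs : List (V n)} → Independent bs → Independent (map (false ∷_) bs)
independent-false∷ {bs = []}     _       = tt
independent-false∷ {bs = b ∷ bs} (p , q) = notIn , independent-false∷ q
  where
  notIn : ¬ ((false ∷ b) ∈⟨ map (false ∷_) bs ⟩)
  notIn r with x , s , refl ← ∈⟨⟩-map⁻ false∷-linear bs r = p s

basis-independent : (s : Sub m c) → Independent (basis s)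
basis-independent []          = tt
basis-independent (free s)    = independent-false∷ (basis-independent s)
basis-independent (pivot v s) = notIn , independent-false∷ (basis-independent s)
  where
  notIn : ¬ ((true ∷ lift s v) ∈⟨ map (false ∷_) (basis s) ⟩)
  notIn r with _ , _ , () ← ∈⟨⟩-map⁻ false∷-linear (basis s) r

-- From echelon forms to subspaces with bases

module Dimension (n : ℕ) where
  open Subspaces (vectorSpace n)

  linearCombination-∈ : (bs : List (V n)) (a : Fin (length bs) → Bool) → linearCombination a (List.lookup bs) ∈⟨ bs ⟩
  linearCombination-∈ []       a = refl
  linearCombination-∈ (b ∷ bs) a with a zero
  ... | true  = inj₂ (subst (_∈⟨ bs ⟩) (sym (⊕-cancel b _)) (linearCombination-∈ bs (a ∘ suc)))
  ... | false = inj₁ (subst (_∈⟨ bs ⟩) (sym (⊕-identityˡ _)) (linearCombination-∈ bs (a ∘ suc)))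

  ∈⇒linearCombination : (bs : List (V n)) {x : V n} → x ∈⟨ bs ⟩ → ∃ λ a → linearCombination a (List.lookup bs) ≡ x
  ∈⇒linearCombination []       refl = (λ ()) , refl
  ∈⇒linearCombination (b ∷ bs) (inj₁ p) with a , eq ← ∈⇒linearCombination bs p =
    false Vector.∷ a , trans (⊕-identityˡ _) eq
  ∈⇒linearCombination (b ∷ bs) {x} (inj₂ p) with a , eq ← ∈⇒linearCombination bs p =
    true Vector.∷ a , trans (cong (b ⊕_) eq) (⊕-cancel b x)

  linearlyIndependent : (bs : List (V n)) → Independent bs → LinearlyIndependent (List.lookup bs)
  linearlyIndependent (b ∷ bs) (p , q) a eq i with a zero in eq₀
  linearlyIndependent (b ∷ bs) (p , q) a eq i       | true =
    contradiction (subst (_∈⟨ bs ⟩) (sym (⊕≡𝟘⇒≡ b _ eq)) (linearCombination-∈ bs (a ∘ suc))) p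
  linearlyIndependent (b ∷ bs) (p , q) a eq zero    | false = eq₀
  linearlyIndependent (b ∷ bs) (p , q) a eq (suc i) | false =
    linearlyIndependent bs q (a ∘ suc) (trans (sym (⊕-identityˡ _)) eq) i

  Represents : Sub n c → Subspace → Set
  Represents s W = ∀ x → carrier W x ⇔ x ∈ₛ s

  hasDimension : ∀ {s : Sub n c} {W} → Represents s W → k + c ≡ n → HasDimension W k
  hasDimension {c = c} {s = s} {W} e eq =
    subst (HasDimension W) (ℕ.+-cancelʳ-≡ c _ _ (trans (length-basis s) (sym eq)))
      ( List.lookup (basis s)
      , record
        { member      = λ i → from (e _) (from (∈-basis s) (∈⇒∈⟨⟩ (∈-lookup i)))
        ; independent = linearlyIndependent (basis s) (basis-independent s)
        ; spanning    = λ {x} p → ∈⇒linearCombination (basis s) (to (∈-basis s) (to (e x) p))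
        } )

  subspace : Sub n c → Subspace
  subspace s = record
    { carrier   = _∈ₛ s
    ; resp-≈    = λ { refl p → p }
    ; 0-closed  = ∈ₛ-𝟘 s
    ; +-closed  = ∈ₛ-⊕ s
    ; *ₗ-closed = λ { true p → p ; false p → ∈ₛ-𝟘 s }
    }

  module Plane {T : Subspace} {b : Fin 2 → V n} (isBasis : IsBasis T b) where
    open IsBasis isBasis

    x y : V n
    x = b zero
    y = b (suc zero)

    private
      coefficients : Bool → Bool → Fin 2 → Bool
      coefficients p q zero       = p
      coefficients p q (suc zero) = q

      trivial : ∀ p q → p · x ⊕ (q · y ⊕ 𝟘) ≡ 𝟘 → p ≡ false × q ≡ false
      trivial p q eq = independent (coefficients p q) eq zero , independent (coefficients p q) eq (suc zero)

    x≢𝟘 : x ≢ 𝟘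
    x≢𝟘 eq with () ← proj₁ (trivial true false (trans (cong (x ⊕_) (⊕-identityʳ 𝟘)) (trans (⊕-identityʳ x) eq)))

    y≢𝟘 : y ≢ 𝟘
    y≢𝟘 eq with () ← proj₂ (trivial false true (trans (⊕-identityˡ _) (trans (⊕-identityʳ y) eq)))

    x≢y : x ≢ y
    x≢y eq with () ← proj₁ (trivial true true (trans (cong₂ _⊕_ eq (⊕-identityʳ y)) (⊕-self y)))

    -- Turns containment of a 2-space into the condition on two vectors that `ThroughLine` counts.
    ⊆⇔ : (s : Sub n c) → (∀ {t} → carrier T t → t ∈ₛ s) ⇔ (x ∈ₛ s × y ∈ₛ s)
    ⊆⇔ s = mk⇔ restrict (λ (p , q) {t} r → include p q (spanning r))
      where
      restrict : (∀ {t} → carrier T t → t ∈ₛ s) → x ∈ₛ s × y ∈ₛ s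
      restrict f = f (member zero) , f (member (suc zero))
      scale : ∀ a {u} → u ∈ₛ s → a · u ∈ₛ s
      scale = Subspace.*ₗ-closed (subspace s)
      include : x ∈ₛ s → y ∈ₛ s → ∀ {t} → (∃ λ a → linearCombination a b ≡ t) → t ∈ₛ s
      include p q (a , refl) = ∈ₛ-⊕ s (scale (a zero) p) (∈ₛ-⊕ s (scale (a (suc zero)) q) (∈ₛ-𝟘 s))

-- Counting with duplicate-free lists

record Card {A : Set} (P : Pred A 0ℓ) (l : ℕ) : Set where
  field
    list     : List A
    unique   : Unique list
    sound    : ∀ {a} → a ∈ list → P a
    complete : ∀ {a} → P a → a ∈ list
    size     : length list ≡ l

open Card

module _ {A : Set} {P Q : Pred A 0ℓ} where

  card-⇔ : (∀ a → P a ⇔ Q a) → Card P l → Card Q l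
  card-⇔ e C = record
    { list = list C ; unique = unique C ; size = size C
    ; sound = to (e _) ∘ sound C ; complete = complete C ∘ from (e _) }

  card-⊎ : (∀ {a} → P a → ¬ Q a) → Card P k → Card Q l → Card (λ a → P a ⊎ Q a) (k + l)
  card-⊎ disjoint C D = record
    { list     = list C ++ list D
    ; unique   = Unique.++⁺ (unique C) (unique D) λ (p , q) → disjoint (sound C p) (sound D q)
    ; sound    = Sum.map (sound C) (sound D) ∘ ∈-++⁻ (list C)
    ; complete = [ ∈-++⁺ˡ ∘ complete C , ∈-++⁺ʳ (list C) ∘ complete D ]′
    ; size     = trans (List.length-++ (list C)) (cong₂ _+_ (size C) (size D))
    }

module _ {A B : Set} {P : Pred A 0ℓ} where

  card-image : (f : A → B) → (∀ {a a′} → f a ≡ f a′ → a ≡ a′) → Card P l →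
               Card (λ b → ∃ λ a → P a × b ≡ f a) l
  card-image f inj C = record
    { list     = map f (list C)
    ; unique   = Unique.map⁺ inj (unique C)
    ; sound    = λ p → let a , q , eq = ∈-map⁻ f p in a , sound C q , eq
    ; complete = λ { (a , q , refl) → ∈-map⁺ f (complete C q) }
    ; size     = trans (List.length-map f (list C)) (size C)
    }

length-cartesianProductWith : {A B C : Set} (f : A → B → C) (xs : List A) (ys : List B) →
                              length (cartesianProductWith f xs ys) ≡ length xs * length ys
length-cartesianProductWith f []       ys = refl
length-cartesianProductWith f (x ∷ xs) ys = trans (List.length-++ (map (f x) ys))
  (cong₂ _+_ (List.length-map (f x) ys) (length-cartesianProductWith f xs ys))

allVectors : ∀ n → List (V n)
allVectors zero    = [] ∷ []
allVectors (suc n) = cartesianProductWith _∷_ (true ∷ false ∷ []) (allVectors n)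

∈-allVectors : (x : V n) → x ∈ allVectors n
∈-allVectors []          = here refl
∈-allVectors (true ∷ x)  = ∈-cartesianProductWith⁺ _∷_ {xs = true ∷ false ∷ []} (here refl) (∈-allVectors x)
∈-allVectors (false ∷ x) = ∈-cartesianProductWith⁺ _∷_ {xs = true ∷ false ∷ []} (there (here refl)) (∈-allVectors x)

allVectors-unique : ∀ n → Unique (allVectors n)
allVectors-unique zero    = [] ∷ []
allVectors-unique (suc n) =
  Unique.cartesianProductWith⁺ _∷_ (λ { refl → refl , refl }) (((λ ()) ∷ []) ∷ ([] ∷ [])) (allVectors-unique n)

length-allVectors : ∀ n → length (allVectors n) ≡ 2 ^ n
length-allVectors zero    = refl
length-allVectors (suc n) = trans (length-cartesianProductWith _∷_ (true ∷ false ∷ []) (allVectors n))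
                                  (cong (2 *_) (length-allVectors n))

-- The vectors `y` run over the 2^c cosets of a space of codimension `c`.
card-pivot : {P : Pred (Sub m c) 0ℓ} → Card P l → Card (λ s → ∃ λ y → ∃ λ r → P r × s ≡ pivot y r) (2 ^ c * l)
card-pivot {c = c} C = record
  { list     = cartesianProductWith pivot (allVectors c) (list C)
  ; unique   = Unique.cartesianProductWith⁺ pivot (λ { refl → refl , refl }) (allVectors-unique c) (unique C)
  ; sound    = λ p → let y , r , _ , q , eq = ∈-cartesianProductWith⁻ pivot (allVectors c) (list C) p
                     in y , r , sound C q , eq
  ; complete = λ { (y , r , q , refl) → ∈-cartesianProductWith⁺ pivot (∈-allVectors y) (complete C q) }
  ; size     = trans (length-cartesianProductWith pivot (allVectors c) (list C))
                     (cong₂ _*_ (length-allVectors c) (size C))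
  }

index-∈-lookup : {A : Set} (xs : List A) (i : Fin (length xs)) → index (∈-lookup {xs = xs} i) ≡ i
index-∈-lookup (x ∷ xs) zero    = refl
index-∈-lookup (x ∷ xs) (suc i) = cong suc (index-∈-lookup xs i)

ThroughPoint : Pred (Sub m c) 0ℓ → V m → Pred (Sub m c) 0ℓ
ThroughPoint D u s = D s × u ∈ₛ s

ThroughLine : Pred (Sub m c) 0ℓ → V m → V m → Pred (Sub m c) 0ℓ
ThroughLine D u w s = D s × u ∈ₛ s × w ∈ₛ s

-- Extending two designs from U to GF(2) × U

-- The 4-spaces of GF(2) × U not contained in U are pairs of a 3-space s of U
-- and a coset y of s: they are the subspaces `pivot y s`.  So a 2-(n,3,l₃)
-- design D₃ and a 2-(n,4,l₄) design D₄ in U combine to a design in GF(2) × U.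
module Extension {e : ℕ} (D₃ : Pred (Sub (4 + e) (suc e)) 0ℓ) (D₄ : Pred (Sub (4 + e) e) 0ℓ) where

  -- Since dim U = 4 + e, a 3-space of U has codimension `suc e` and a 4-space has `e`. A 4-space of
  -- the extension has `suc e` again: `free` raises the codimension, `pivot` keeps it.
  Block₀ : Pred (Sub (5 + e) (suc e)) 0ℓ
  Block₀ (free s)    = D₄ s
  Block₀ (pivot y s) = D₃ s

  module _ {l₁ l₃ l₄ l : ℕ}
    (points  : ∀ {u} → u ≢ 𝟘 → Card (ThroughPoint D₃ u) l₁)
    (lines₃ : ∀ {u w} → u ≢ 𝟘 → w ≢ 𝟘 → u ≢ w → Card (ThroughLine D₃ u w) l₃)
    (lines₄ : ∀ {u w} → u ≢ 𝟘 → w ≢ 𝟘 → u ≢ w → Card (ThroughLine D₄ u w) l₄)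
    (outer : l₁ ≡ l) (inner : l₄ + 2 ^ suc e * l₃ ≡ l) where

    private
      swap : ∀ {x y} → Card (ThroughLine Block₀ x y) l → Card (ThroughLine Block₀ y x) l
      swap = card-⇔ λ s → mk⇔ (λ (b , p , q) → b , q , p) (λ (b , p , q) → b , q , p)

    -- Blocks inside U are counted by `lines₄`; every member of D₃ through the line contributes all
    -- of its 2^(suc e) cosets.
    linesInside : ∀ {u w} → u ≢ 𝟘 → w ≢ 𝟘 → u ≢ w → Card (ThroughLine Block₀ (false ∷ u) (false ∷ w)) l
    linesInside {u} {w} u≢𝟘 w≢𝟘 u≢w = subst (Card _) inner $ card-⇔ equivalence $
      card-⊎ (λ { (_ , _ , refl) (_ , _ , _ , ()) })
        (card-image free (λ { refl → refl }) (lines₄ u≢𝟘 w≢𝟘 u≢w)) (card-pivot (lines₃ u≢𝟘 w≢𝟘 u≢w))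
      where
      Cases : Pred (Sub (5 + e) (suc e)) 0ℓ
      Cases s = (∃ λ r → ThroughLine D₄ u w r × s ≡ free r) ⊎
                (∃ λ y → ∃ λ r → ThroughLine D₃ u w r × s ≡ pivot y r)

      equivalence : ∀ s → Cases s ⇔ ThroughLine Block₀ (false ∷ u) (false ∷ w) s
      equivalence s = mk⇔
        (λ { (inj₁ (r , (b , p , q) , refl)) → b , cong (false ∷_) p , cong (false ∷_) q
           ; (inj₂ (y , r , t , refl)) → t })
        (back s)
        where
        back : ∀ s → ThroughLine Block₀ (false ∷ u) (false ∷ w) s → Cases s
        back (free r)    (b , p , q) = inj₁ (r , (b , cong Vec.tail p , cong Vec.tail q) , refl)
        back (pivot y r) t           = inj₂ (y , r , t , refl)

    -- The vector `true ∷ z` lies in `pivot y r` only for y = `proj r z`. The coset being forced,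
    -- the blocks correspond to the members of D₃ through `u`.
    linesCrossing : ∀ {z u} → u ≢ 𝟘 → Card (ThroughLine Block₀ (true ∷ z) (false ∷ u)) l
    linesCrossing {z} {u} u≢𝟘 = subst (Card _) outer $ card-⇔ equivalence $
      card-image (λ r → pivot (proj r z) r) (λ { refl → refl }) (points u≢𝟘)
      where
      Extended : Pred (Sub (5 + e) (suc e)) 0ℓ
      Extended s = ∃ λ r → ThroughPoint D₃ u r × s ≡ pivot (proj r z) r

      equivalence : ∀ s → Extended s ⇔ ThroughLine Block₀ (true ∷ z) (false ∷ u) s
      equivalence s = mk⇔ (λ { (r , (b , p) , refl) → b , ⊕-self (proj r z) , p }) (back s)
        where
        back : ∀ s → ThroughLine Block₀ (true ∷ z) (false ∷ u) s → Extended s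
        back (free r)    (b , p , q) = contradiction (cong Vec.head p) (λ ())
        back (pivot y r) (b , p , q) = r , (b , q) , cong (λ v → pivot v r) (⊕≡𝟘⇒≡ y (proj r z) p)

    lines : ∀ {x y} → x ≢ 𝟘 → y ≢ 𝟘 → x ≢ y → Card (ThroughLine Block₀ x y) l
    lines {false ∷ u} {false ∷ w} p q r =
      linesInside (p ∘ cong (false ∷_)) (q ∘ cong (false ∷_)) (r ∘ cong (false ∷_))
    lines {true ∷ z}  {false ∷ w} p q r = linesCrossing (q ∘ cong (false ∷_))
    lines {false ∷ u} {true ∷ z}  p q r = swap (linesCrossing (p ∘ cong (false ∷_)))
    -- Two vectors outside U have their sum in U; replacing the second by the sum keeps the line.
    lines {true ∷ z}  {true ∷ z′} p q r = card-⇔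
      (λ s → mk⇔ (λ (b , p , q) → b , p , ∈ₛ-cancel s p q) (λ (b , p , q) → b , p , ∈ₛ-⊕ s p q))
      (linesCrossing {z} {z ⊕ z′} (r ∘ cong (true ∷_) ∘ ⊕≡𝟘⇒≡ z z′))

    open Subspaces (vectorSpace (5 + e))
    open Dimension (5 + e)

    Block : Pred Subspace 0ℓ
    Block W = ∃ λ s → Block₀ s × Represents s W

    full : ∀ m → Sub m 0
    full zero    = []
    full (suc m) = pivot [] (full m)

    -- A block goes to the place of its echelon form in the list. This depends only on its vectors,
    -- because echelon forms are canonical and membership in a duplicate-free list has only one
    -- proof.
    hasCardinality : ∀ T → HasDimension T 2 → HasCardinality (containing Block T) l
    hasCardinality T (b , isBasis) = subst (HasCardinality (containing Block T)) (size C) record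
      { to        = λ p → index (position p)
      ; from      = block
      ; to-cong   = λ {p} {q} → position-cong p q
      ; from-cong = λ { refl → id , id }
      ; inverse   = (λ {i} {p} eq → trans (position-cong p (block i) eq) (block-position i))
                  , (λ {p} {i} eq → subst (λ i → containing-≈ (block i) p) (sym eq) (position-block p))
      }
      where
      open Plane {T} {b} isBasis
      C = lines x≢𝟘 y≢𝟘 x≢y

      Element = Σ Subspace λ W → Block W × (∀ {t} → carrier T t → carrier W t)

      containing-≈ : Element → Element → Set
      containing-≈ (W , _) (W′ , _) = (∀ {t} → carrier W t → carrier W′ t) × (∀ {t} → carrier W′ t → carrier W t)

      sub : Element → Sub (5 + e) (suc e)
      sub (W , (s , _) , _) = s

      position : (p : Element) → sub p ∈ list C
      position (W , (s , B , E) , T⊆W) = complete C (B , to (⊆⇔ s) (to (E _) ∘ T⊆W))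

      index-cong : ∀ {s s′} (p : s ∈ list C) (q : s′ ∈ list C) → s ≡ s′ → index p ≡ index q
      index-cong p q refl = cong index (unique⇒irrelevant (unique C) p q)

      position-cong : ∀ p q → containing-≈ p q → index (position p) ≡ index (position q)
      position-cong p@(W , (s , B , E) , _) q@(W′ , (s′ , B′ , E′) , _) (f , g) =
        index-cong (position p) (position q) (≡-by-members′ s s′ λ x →
          mk⇔ (to (E′ x) ∘ f ∘ from (E x)) (to (E x) ∘ g ∘ from (E′ x)))

      block : Fin (length (list C)) → Element
      block i = subspace s , (s , proj₁ t , λ x → mk⇔ id id) , from (⊆⇔ s) (proj₂ t)
        where
        s = List.lookup (list C) i
        t = sound C (∈-lookup i)

      block-position : ∀ i → index (position (block i)) ≡ i
      block-position i = trans (index-cong (position (block i)) (∈-lookup i) refl) (index-∈-lookup (list C) i)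

      position-block : ∀ p → containing-≈ (block (index (position p))) p
      position-block p@(W , (s , _ , E) , _) =
        subst (λ r → (∀ {t} → t ∈ₛ r → carrier W t) × (∀ {t} → carrier W t → t ∈ₛ r))
          (Any.lookup-index (position p)) (from (E _) , to (E _))

    design : SubspaceDesign 2 (5 + e) 4 l
    design = record
      { V               = vectorSpace (5 + e)
      ; V-dimension     = hasDimension {s = full _} {whole} (λ x → mk⇔ (λ _ → empty _) _) (ℕ.+-identityʳ _)
      ; Block           = Block
      ; Block-resp-≐    = λ { (f , g) (s , B , E) → s , B , λ x → mk⇔ (to (E x) ∘ g) (f ∘ from (E x)) }
      ; Block-dimension = λ { {W} (s , B , E) → hasDimension {s = s} {W} E (ℕ.+-suc 4 e) }
      ; balanced        = hasCardinality
      }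
      where
      empty : (x : V 0) → x ≡ []
      empty [] = refl

-- Linear isomorphisms and transport of counts

-- A new generator lowers the codimension exactly if it is outside the span so far, and an injective
-- linear map preserves this alternative.
codim-span-map : {f : V n → V n} → Linear f → (∀ {x y} → f x ≡ f y → x ≡ y) → (bs : List (V n)) →
                 proj₁ (span (map f bs)) ≡ proj₁ (span bs)
codim-span-map lin inj []       = refl
codim-span-map {f = f} lin inj (b ∷ bs) with proj (proj₂ (span bs)) b ≟ᵥ 𝟘
  where
  _≟ᵥ_ = Vec.≡-dec Bool._≟_
... | yes p = begin
  proj₁ (add (f b) (span (map f bs))) ≡⟨ codim-add-∈ (f b) (span (map f bs))
                                           (from (∈-span (map f bs)) (∈⟨⟩-map⁺ lin bs (to (∈-span bs) p))) ⟩
  proj₁ (span (map f bs))             ≡⟨ codim-span-map lin inj bs ⟩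
  proj₁ (span bs)                     ≡⟨ codim-add-∈ b (span bs) p ⟨
  proj₁ (add b (span bs))             ∎
  where open ≡-Reasoning
... | no p = ℕ.suc-injective (begin
  suc (proj₁ (add (f b) (span (map f bs)))) ≡⟨ codim-add-∉ (f b) (span (map f bs)) notIn ⟩
  proj₁ (span (map f bs))                   ≡⟨ codim-span-map lin inj bs ⟩
  proj₁ (span bs)                           ≡⟨ codim-add-∉ b (span bs) p ⟨
  suc (proj₁ (add b (span bs)))             ∎)
  where
  open ≡-Reasoning
  notIn : ¬ (f b ∈ₚ span (map f bs))
  notIn q with x , r , eq ← ∈⟨⟩-map⁻ lin bs (to (∈-span (map f bs)) q) =
    p (from (∈-span bs) (subst (_∈⟨ bs ⟩) (inj eq) r))

record LinearIso (n : ℕ) : Set where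
  field
    fun inv    : V n → V n
    fun-linear : Linear fun
    inv-linear : Linear inv
    fun-inv    : ∀ x → fun (inv x) ≡ x
    inv-fun    : ∀ x → inv (fun x) ≡ x

  ∈-map-inv : (bs : List (V n)) {x : V n} → x ∈⟨ map inv bs ⟩ ⇔ fun x ∈⟨ bs ⟩
  ∈-map-inv bs {x} = mk⇔
    (λ p → let y , q , eq = ∈⟨⟩-map⁻ inv-linear bs p
           in subst (_∈⟨ bs ⟩) (trans (sym (fun-inv y)) (cong fun eq)) q)
    (λ p → subst (_∈⟨ map inv bs ⟩) (inv-fun x) (∈⟨⟩-map⁺ inv-linear bs p))

  inv-injective : ∀ {x y} → inv x ≡ inv y → x ≡ y
  inv-injective {x} {y} eq = trans (sym (fun-inv x)) (trans (cong fun eq) (fun-inv y))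

  abstract
    -- The images of a basis under `inv` span the preimage. Its codimension equals that of the span
    -- of the basis itself, which is `s` by canonicity; so the preimage can be given the codimension
    -- `c` in its type.
    preimage,members : (s : Sub n c) → Σ (Sub n c) λ r → ∀ x → x ∈ₛ r ⇔ fun x ∈ₛ s
    preimage,members {c} s with span (map inv (basis s)) | codim-span-map inv-linear inv-injective (basis s)
                      | (λ x → ∈-span (map inv (basis s)) {x})
                      | ≡-by-members s (proj₂ (span (basis s)))
                          (λ x p → from (∈-span (basis s)) (to (∈-basis s) p))
                          (λ x p → from (∈-basis s) (to (∈-span (basis s)) p))
    ... | _ , r | eq | e | eq′ with refl ← trans eq (sym (cong proj₁ eq′)) =
      r , λ x → mk⇔ (from (∈-basis s) ∘ to (∈-map-inv (basis s)) ∘ to (e x))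
                    (from (e x) ∘ from (∈-map-inv (basis s)) ∘ to (∈-basis s))

    preimage : Sub n c → Sub n c
    preimage s = proj₁ (preimage,members s)

    ∈-preimage : (s : Sub n c) (x : V n) → x ∈ₛ preimage s ⇔ fun x ∈ₛ s
    ∈-preimage s = proj₂ (preimage,members s)

open LinearIso

iso-sym : LinearIso n → LinearIso n
iso-sym g = record
  { fun = inv g ; inv = fun g ; fun-linear = inv-linear g ; inv-linear = fun-linear g
  ; fun-inv = inv-fun g ; inv-fun = fun-inv g }

preimage-sym : (g : LinearIso n) (s : Sub n c) → preimage (iso-sym g) (preimage g s) ≡ s
preimage-sym g s = ≡-by-members′ _ s λ x → mk⇔
  (λ p → subst (_∈ₛ s) (fun-inv g x) (to (∈-preimage g s (inv g x)) (to (∈-preimage (iso-sym g) _ x) p)))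
  (λ p → from (∈-preimage (iso-sym g) _ x) (from (∈-preimage g s (inv g x)) (subst (_∈ₛ s) (sym (fun-inv g x)) p)))

card-preimage : (g : LinearIso n) {P Q : Pred (Sub n c) 0ℓ} →
  (∀ s → P s ⇔ Q (preimage g s)) → Card P l → Card Q l
card-preimage g {P} {Q} e C = card-⇔ (λ r → mk⇔
    (λ { (s , p , refl) → to (e s) p })
    (λ q → preimage g⁻¹ r , from (e _) (subst Q (sym (preimage-sym g⁻¹ r)) q) , sym (preimage-sym g⁻¹ r)))
  (card-image (preimage g) injective C)
  where
  g⁻¹ = iso-sym g
  injective : ∀ {s s′} → preimage g s ≡ preimage g s′ → s ≡ s′
  injective {s} {s′} eq = trans (sym (preimage-sym g s)) (trans (cong (preimage g⁻¹) eq) (preimage-sym g s′))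

-- Sets of subspaces as tries

-- The echelon form is written from its innermost constructor outwards, so
-- that the codimension, hence the length of the next vector, is known when
-- the key is read.
key : Sub m c → List Bool → List Bool
key []          ks = ks
key (free s)    ks = key s (false ∷ ks)
key (pivot v s) ks = key s (true ∷ Vec.toList v ++ ks)

toList-++-injective : (u v : V n) {ks ls : List Bool} → Vec.toList u ++ ks ≡ Vec.toList v ++ ls → u ≡ v × ks ≡ ls
toList-++-injective []      []      eq = refl , eq
toList-++-injective (a ∷ u) (b ∷ v) eq with refl , eq′ ← List.∷-injective eq =
  Prod.map (cong (a ∷_)) id (toList-++-injective u v eq′)

-- Arbitrary tails carry the induction. The inner echelon forms are compared first, which equates
-- the codimensions; then the pivot entries have equal length and can be split off. Different
-- constructors leave tails with different first bits.
key-injective : (s : Sub m c) (r : Sub m d) {ks ls : List Bool} → key s ks ≡ key r ls →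
                _≡_ {A = Space m} (c , s) (d , r) × ks ≡ ls
key-injective []          []          eq = refl , eq
key-injective (free s)    (free r)    eq with refl , refl ← key-injective s r eq = refl , refl
key-injective (free s)    (pivot v r) eq with () ← proj₂ (key-injective s r eq)
key-injective (pivot v s) (free r)    eq with () ← proj₂ (key-injective s r eq)
key-injective (pivot v s) (pivot u r) eq with refl , eq′ ← key-injective s r eq
  with refl , refl ← toList-++-injective v u (List.∷-injectiveʳ eq′) = refl , refl

-- A lookup costs the length of a key whatever the number of blocks, and repeated presentations of a
-- block merge.
data Trie : Set where
  ∅    : Trie
  node : Bool → Trie → Trie → Trie

insert : List Bool → Trie → Trie
insert []           ∅            = node true ∅ ∅
insert (true ∷ ks)  ∅            = node false (insert ks ∅) ∅
insert (false ∷ ks) ∅            = node false ∅ (insert ks ∅)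
insert []           (node b l r) = node true l r
insert (true ∷ ks)  (node b l r) = node b (insert ks l) r
insert (false ∷ ks) (node b l r) = node b l (insert ks r)

member : List Bool → Trie → Bool
member ks           ∅            = false
member []           (node b l r) = b
member (true ∷ ks)  (node b l r) = member ks l
member (false ∷ ks) (node b l r) = member ks r

member-insert : ∀ ks t → T (member ks (insert ks t))
member-insert []           ∅            = tt
member-insert (true ∷ ks)  ∅            = member-insert ks ∅
member-insert (false ∷ ks) ∅            = member-insert ks ∅
member-insert []           (node b l r) = tt
member-insert (true ∷ ks)  (node b l r) = member-insert ks l
member-insert (false ∷ ks) (node b l r) = member-insert ks r

insert-⊇ : ∀ ks ls t → T (member ks t) → T (member ks (insert ls t))
insert-⊇ []           []           (node b l r) p = tt
insert-⊇ []           (true ∷ ls)  (node b l r) p = p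
insert-⊇ []           (false ∷ ls) (node b l r) p = p
insert-⊇ (true ∷ ks)  []           (node b l r) p = p
insert-⊇ (false ∷ ks) []           (node b l r) p = p
insert-⊇ (true ∷ ks)  (true ∷ ls)  (node b l r) p = insert-⊇ ks ls l p
insert-⊇ (true ∷ ks)  (false ∷ ls) (node b l r) p = p
insert-⊇ (false ∷ ks) (true ∷ ls)  (node b l r) p = p
insert-⊇ (false ∷ ks) (false ∷ ls) (node b l r) p = insert-⊇ ks ls r p

insert-member : ∀ ks ls t → T (member ks (insert ls t)) → ks ≡ ls ⊎ T (member ks t)
insert-member []           []           ∅            p = inj₁ refl
insert-member (true ∷ ks)  (true ∷ ls)  ∅            p = Sum.map (cong (true ∷_)) (λ ()) (insert-member ks ls ∅ p)
insert-member (false ∷ ks) (false ∷ ls) ∅            p = Sum.map (cong (false ∷_)) (λ ()) (insert-member ks ls ∅ p)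
insert-member []           []           (node b l r) p = inj₁ refl
insert-member []           (true ∷ ls)  (node b l r) p = inj₂ p
insert-member []           (false ∷ ls) (node b l r) p = inj₂ p
insert-member (true ∷ ks)  []           (node b l r) p = inj₂ p
insert-member (false ∷ ks) []           (node b l r) p = inj₂ p
insert-member (true ∷ ks)  (true ∷ ls)  (node b l r) p = Sum.map (cong (true ∷_)) id (insert-member ks ls l p)
insert-member (true ∷ ks)  (false ∷ ls) (node b l r) p = inj₂ p
insert-member (false ∷ ks) (true ∷ ls)  (node b l r) p = inj₂ p
insert-member (false ∷ ks) (false ∷ ls) (node b l r) p = Sum.map (cong (false ∷_)) id (insert-member ks ls r p)

infix 4 _∈ₜ_
_∈ₜ_ : Sub m c → Trie → Bool
s ∈ₜ t = member (key s []) t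

insertSpace : Space m → Trie → Trie
insertSpace (_ , s) = insert (key s [])

trie : (A → Space m) → List A → Trie
trie f = foldr (insertSpace ∘ f) ∅

∈-trie⁺ : (f : A → Space m) {xs : List A} {x : A} {s : Sub m c} → x ∈ xs → f x ≡ (c , s) → T (s ∈ₜ trie f xs)
∈-trie⁺ f {x ∷ xs} {s = s} (here refl) eq rewrite eq = member-insert (key s []) (trie f xs)
∈-trie⁺ f {x ∷ xs} {s = s} (there p)   eq =
  insert-⊇ (key s []) (key (proj₂ (f x)) []) (trie f xs) (∈-trie⁺ f p eq)

∈-trie⁻ : (f : A → Space m) (xs : List A) {s : Sub m c} → T (s ∈ₜ trie f xs) → ∃ λ x → x ∈ xs × f x ≡ (c , s)
∈-trie⁻ f (x ∷ xs) {s} p with insert-member (key s []) (key (proj₂ (f x)) []) (trie f xs) p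
... | inj₁ eq = x , here refl , sym (proj₁ (key-injective s (proj₂ (f x)) eq))
... | inj₂ q  = let y , r , eq = ∈-trie⁻ f xs q in y , there r , eq

-- Enumeration of the subspaces above a given one

allSubs : ∀ m c → List (Sub m c)
allSubs zero    zero    = [] ∷ []
allSubs zero    (suc c) = []
allSubs (suc m) zero    = map (pivot []) (allSubs m zero)
allSubs (suc m) (suc c) = map free (allSubs m c) ++ cartesianProductWith pivot (allVectors (suc c)) (allSubs m (suc c))

∈-allSubs : (s : Sub m c) → s ∈ allSubs m c
∈-allSubs []                        = here refl
∈-allSubs (free s)                  = ∈-++⁺ˡ (∈-map⁺ free (∈-allSubs s))
∈-allSubs (pivot {c = zero} [] s)   = ∈-map⁺ (pivot []) (∈-allSubs s)
∈-allSubs (pivot {c = suc c} {m = m} v s)   =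
  ∈-++⁺ʳ (map free (allSubs m c)) (∈-cartesianProductWith⁺ pivot (∈-allVectors v) (∈-allSubs s))

allSubs-unique : ∀ m c → Unique (allSubs m c)
allSubs-unique zero    zero    = [] ∷ []
allSubs-unique zero    (suc c) = []
allSubs-unique (suc m) zero    = Unique.map⁺ (λ { refl → refl }) (allSubs-unique m zero)
allSubs-unique (suc m) (suc c) = Unique.++⁺
  (Unique.map⁺ (λ { refl → refl }) (allSubs-unique m c))
  (Unique.cartesianProductWith⁺ pivot (λ { refl → refl , refl }) (allVectors-unique (suc c)) (allSubs-unique m (suc c)))
  disjoint
  where
  disjoint : ∀ {s} → ¬ (s ∈ map free (allSubs m c) × s ∈ cartesianProductWith pivot (allVectors (suc c)) (allSubs m (suc c)))
  disjoint (p , q) with _ , _ , refl ← ∈-map⁻ free p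
    with _ , _ , _ , _ , () ← ∈-cartesianProductWith⁻ pivot (allVectors (suc c)) (allSubs m (suc c)) q

-- Candidates come from the quotient by `s`, each once, and the trie only decides which are blocks.
-- Hence the length counts subspaces even if a block was generated several times.
through : ∀ c → Space n → Trie → List (Sub n c)
through c (d , s) t = filter (λ w → T? (w ∈ₜ t)) (map (comp s) (allSubs d c))

∈-through⁻ : (s : Space n) {t : Trie} {w : Sub n c} → w ∈ through c s t → (∀ {x} → x ∈ₚ s → x ∈ₛ w) × T (w ∈ₜ t)
∈-through⁻ (d , s) {t} p with q , r ← ∈-filter⁻ (λ w → T? (w ∈ₜ t)) {xs = map (comp s) (allSubs d _)} p
  with u , _ , refl ← ∈-map⁻ (comp s) q = comp-⊇ s u , r

∈-through⁺ : (s : Space n) {t : Trie} {w : Sub n c} → (∀ {x} → x ∈ₚ s → x ∈ₛ w) → T (w ∈ₜ t) → w ∈ through c s t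
∈-through⁺ (d , s) {t} {w} p q with u , refl ← factor s w (λ x → p) =
  ∈-filter⁺ (λ w → T? (w ∈ₜ t)) (∈-map⁺ (comp s) (∈-allSubs u)) q

through-unique : ∀ c (s : Space n) t → Unique (through c s t)
through-unique c (d , s) t =
  Unique.filter⁺ (λ w → T? (w ∈ₜ t)) (Unique.map⁺ (comp-injective s) (allSubs-unique d c))

nonzeroSpan : List (V n) → List (V n)
nonzeroSpan []       = []
nonzeroSpan (b ∷ bs) = b ∷ nonzeroSpan bs ++ map (b ⊕_) (nonzeroSpan bs)

∈-nonzeroSpan : (bs : List (V n)) {x : V n} → x ∈⟨ bs ⟩ → x ≢ 𝟘 → x ∈ nonzeroSpan bs
∈-nonzeroSpan []       p ne = contradiction p ne
∈-nonzeroSpan (b ∷ bs) {x} (inj₁ p) ne = there (∈-++⁺ˡ (∈-nonzeroSpan bs p ne))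
∈-nonzeroSpan (b ∷ bs) {x} (inj₂ p) ne with Vec.≡-dec Bool._≟_ (b ⊕ x) 𝟘
... | yes eq = here (sym (⊕≡𝟘⇒≡ b x eq))
... | no ne′ = there (∈-++⁺ʳ (nonzeroSpan bs)
  (subst (_∈ map (b ⊕_) (nonzeroSpan bs)) (⊕-cancel b x) (∈-map⁺ (b ⊕_) (∈-nonzeroSpan bs p ne′))))

-- Tables of powers and logarithms

iterate : (A → A) → ℕ → A → A
iterate f zero    x = x
iterate f (suc k) x = f (iterate f k x)

iterate-+ : (f : A → A) (a b : ℕ) (x : A) → iterate f (a + b) x ≡ iterate f a (iterate f b x)
iterate-+ f zero    b x = refl
iterate-+ f (suc a) b x = cong f (iterate-+ f a b x)

data Tree (A : Set) : Set where
  leaf : A → Tree A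
  fork : ℕ → Tree A → Tree A → Tree A

at : Tree A → ℕ → A
at (leaf x)     k = x
at (fork a l r) k = if k <ᵇ a then at l k else at r (k ∸ a)

module _ {A B : Set} (g : A → B) (f : A → A) where
  -- The second component is the iterate after the last one stored, from which the right half
  -- continues.
  build : ℕ → A → Tree B × A
  build zero    x = leaf (g x) , f x
  build (suc d) x = join (build d x)
    where
    join : Tree B × A → Tree B × A
    join (left , y) = Prod.map₁ (fork (2 ^ d) left) (build d y)

  build-end : ∀ d x → proj₂ (build d x) ≡ iterate f (2 ^ d) x
  build-end zero    x = refl
  build-end (suc d) x = begin
    proj₂ (build d (proj₂ (build d x)))         ≡⟨ build-end d _ ⟩
    iterate f (2 ^ d) (proj₂ (build d x))       ≡⟨ cong (iterate f (2 ^ d)) (build-end d x) ⟩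
    iterate f (2 ^ d) (iterate f (2 ^ d) x)     ≡⟨ iterate-+ f (2 ^ d) (2 ^ d) x ⟨
    iterate f (2 ^ d + 2 ^ d) x                 ≡⟨ cong (λ a → iterate f (2 ^ d + a) x) (ℕ.+-identityʳ (2 ^ d)) ⟨
    iterate f (2 ^ suc d) x                     ∎
    where open ≡-Reasoning

  at-build : ∀ d x {k} → k < 2 ^ d → at (proj₁ (build d x)) k ≡ g (iterate f k x)
  at-build zero    x {zero}  p = refl
  at-build zero    x {suc k} (s≤s ())
  at-build (suc d) x {k} p with k <ᵇ 2 ^ d in eq
  ... | true  = at-build d x (ℕ.<ᵇ⇒< k (2 ^ d) (subst T (sym eq) tt))
  ... | false = begin
    at (proj₁ (build d (proj₂ (build d x)))) (k ∸ 2 ^ d) ≡⟨ at-build d _ bound ⟩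
    g (iterate f (k ∸ 2 ^ d) (proj₂ (build d x)))         ≡⟨ cong (g ∘ iterate f (k ∸ 2 ^ d)) (build-end d x) ⟩
    g (iterate f (k ∸ 2 ^ d) (iterate f (2 ^ d) x))       ≡⟨ cong g (iterate-+ f (k ∸ 2 ^ d) (2 ^ d) x) ⟨
    g (iterate f (k ∸ 2 ^ d + 2 ^ d) x)                   ≡⟨ cong (λ a → g (iterate f a x)) (ℕ.m∸n+n≡m above) ⟩
    g (iterate f k x)                                     ∎
    where
    open ≡-Reasoning
    above : 2 ^ d ≤ k
    above = ℕ.≮⇒≥ λ q → subst T eq (ℕ.<⇒<ᵇ q)
    bound : k ∸ 2 ^ d < 2 ^ d
    bound = ℕ.+-cancelʳ-< (2 ^ d) _ _ (subst₂ _<_ (sym (ℕ.m∸n+n≡m above))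
              (cong (2 ^ d +_) (ℕ.+-identityʳ (2 ^ d))) p)

data LogTable : ℕ → Set where
  ∅    : LogTable n
  leaf : ℕ → LogTable 0
  fork : LogTable n → LogTable n → LogTable (suc n)

record-log : V n → ℕ → LogTable n → LogTable n
record-log []          k t          = leaf k
record-log (true ∷ x)  k ∅          = fork (record-log x k ∅) ∅
record-log (false ∷ x) k ∅          = fork ∅ (record-log x k ∅)
record-log (true ∷ x)  k (fork l r) = fork (record-log x k l) r
record-log (false ∷ x) k (fork l r) = fork l (record-log x k r)

-- The default for an absent vector is harmless: `isLog` tests the value at every nonzero vector.
log : LogTable n → V n → ℕ
log ∅          x           = 0
log (leaf k)   x           = k
log (fork l r) (true ∷ x)  = log l x
log (fork l r) (false ∷ x) = log r x

apply : Vec (V n) m → V m → V n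
apply []       []          = 𝟘
apply (r ∷ rs) (true ∷ t)  = r ⊕ apply rs t
apply (r ∷ rs) (false ∷ t) = apply rs t

apply-∷ : (r : V n) (rs : Vec (V n) m) (h : Bool) (t : V m) → apply (r ∷ rs) (h ∷ t) ≡ h · r ⊕ apply rs t
apply-∷ r rs true  t = refl
apply-∷ r rs false t = sym (⊕-identityˡ _)

apply-linear : (rs : Vec (V n) m) → Linear (apply rs)
apply-linear []       []      []      = sym (⊕-self 𝟘)
apply-linear (r ∷ rs) (a ∷ x) (b ∷ y) = begin
  apply (r ∷ rs) ((a xor b) ∷ (x ⊕ y))           ≡⟨ apply-∷ r rs (a xor b) (x ⊕ y) ⟩
  (a xor b) · r ⊕ apply rs (x ⊕ y)               ≡⟨ cong₂ _⊕_ (xor-· a b r) (apply-linear rs x y) ⟩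
  (a · r ⊕ b · r) ⊕ (apply rs x ⊕ apply rs y)    ≡⟨ ⊕-interchange (a · r) (b · r) (apply rs x) (apply rs y) ⟩
  (a · r ⊕ apply rs x) ⊕ (b · r ⊕ apply rs y)    ≡⟨ cong₂ _⊕_ (apply-∷ r rs a x) (apply-∷ r rs b y) ⟨
  apply (r ∷ rs) (a ∷ x) ⊕ apply (r ∷ rs) (b ∷ y) ∎
  where open ≡-Reasoning

iterate-linear : {f : V n → V n} → Linear f → ∀ k → Linear (iterate f k)
iterate-linear lin zero    x y = refl
iterate-linear {f = f} lin (suc k) x y = trans (cong f (iterate-linear lin k x y)) (lin _ _)

infix 4 _≡ᵛ_
_≡ᵛ_ : V n → V n → Bool
[]          ≡ᵛ []          = true
(true ∷ x)  ≡ᵛ (true ∷ y)  = x ≡ᵛ y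
(false ∷ x) ≡ᵛ (false ∷ y) = x ≡ᵛ y
(_ ∷ _)     ≡ᵛ (_ ∷ _)     = false

≡ᵛ⇒≡ : (x y : V n) → T (x ≡ᵛ y) → x ≡ y
≡ᵛ⇒≡ []          []          t = refl
≡ᵛ⇒≡ (true ∷ x)  (true ∷ y)  t = cong (true ∷_) (≡ᵛ⇒≡ x y t)
≡ᵛ⇒≡ (false ∷ x) (false ∷ y) t = cong (false ∷_) (≡ᵛ⇒≡ x y t)

≡ᵛ-refl : (x : V n) → T (x ≡ᵛ x)
≡ᵛ-refl []          = tt
≡ᵛ-refl (true ∷ x)  = ≡ᵛ-refl x
≡ᵛ-refl (false ∷ x) = ≡ᵛ-refl x

all-∈ : (p : A → Bool) {xs : List A} → T (all p xs) → ∀ {x} → x ∈ xs → T (p x)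
all-∈ p {xs} t = All.lookup (All.all⁺ p xs t)

any-∈ : (p : A → Bool) (xs : List A) → T (any p xs) → ∃ λ x → x ∈ xs × T (p x)
any-∈ p xs t = find (Any.any⁻ p xs t)

nonempty-∈ : (xs : List A) → T (not (null xs)) → ∃ λ x → x ∈ xs
nonempty-∈ (x ∷ xs) _ = x , here refl

∧⁻ : ∀ {a b} → T (a ∧ b) → T a × T b
∧⁻ {a} = to (Bool.T-∧ {a})

∨⁻ : ∀ {a b} → T (a ∨ b) → T a ⊎ T b
∨⁻ {a} = to (Bool.T-∨ {a})

-- Orbits under multiplication and Frobenius, and their checks

-- GF(2^n) with primitive element α, a root of x^n + taps; the first
-- coordinate is that of x^(n-1).  The multiplicative group is {α^k}, of
-- order N = suc N′, and φ is the Frobenius power x ↦ x^μ, whose order divides J = suc J′.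
module Orbits {n′ : ℕ} (taps : V (suc n′)) (N′ μ J′ : ℕ) where

  n₀ N J : ℕ
  n₀ = suc n′
  N  = suc N′
  J  = suc J′

  -- Multiplication by x: a shift, in which an overflowing x^n is replaced by `taps`.
  α : V n₀ → V n₀
  α (h ∷ x) = (x Vec.∷ʳ false) ⊕ h · taps

  one : V n₀
  one = 𝟘 Vec.∷ʳ true

  pow : ℕ → V n₀ → V n₀
  pow = iterate α

  exp : ℕ → V n₀
  exp k = pow k one

  -- Coordinate i belongs to x^(n′ - i), whose μ-th power is recorded. Prescribed on a basis, φ is
  -- linear by construction; that it is the power map on all α^k is the content of `isFrobenius`.
  φ-images : Vec (V n₀) n₀
  φ-images = Vec.tabulate (λ i → exp (μ * (n′ ∸ Fin.toℕ i)))

  φ : V n₀ → V n₀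
  φ = apply φ-images

  -- exponents of a basis of α^c φ^j K, for m = μ^j
  affine : ℕ → ℕ → List ℕ → List ℕ
  affine c m = map (λ a → c + m * a)

  module Computation (E : Tree (V n₀)) (L : LogTable n₀) where

    fastExp : ℕ → V n₀
    fastExp k = at E (k % N)

    -- This is α^N = 1; that the powers of α exhaust the nonzero vectors is tested by `isLog`.
    isPrimitive : Bool
    isPrimitive = α (fastExp N′) ≡ᵛ one

    isFrobenius : Vec (V n₀) n₀ → Bool
    isFrobenius images = all (λ k → apply images (fastExp k) ≡ᵛ fastExp (μ * k)) (upTo N)

    isLog : Bool
    isLog = all (λ v → (v ≡ᵛ 𝟘) ∨ (fastExp (log L v) ≡ᵛ v)) (allVectors n₀)

    isField : Bool
    isField = isPrimitive ∧ isFrobenius φ-images ∧ isLog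

    powers : List ℕ
    powers = map (μ ^_) (upTo J)

    spanExp : List ℕ → Space n₀
    spanExp K = span (map fastExp K)

    logs : List (V n₀) → List ℕ
    logs bs = map (log L) (nonzeroSpan bs)

    -- α^e goes to 1, as m (N′ e) + m e = m e N
    normalize : ℕ → ℕ → List ℕ → List ℕ
    normalize e m = affine (m * (N′ * e)) m

    -- An image of the span of K contains 1 exactly if some member α^e of that span goes to 1. The
    -- shift is then fixed by e and the Frobenius power, which leaves finitely many images.
    throughOne : List (List ℕ) → List (List ℕ)
    throughOne = concatMap λ K → concatMap (λ e → map (λ m → normalize e m K) powers) (logs (map fastExp K))

    Frames : Set
    Frames = Tree (List ℕ)

    multipliers : List (V n₀) → ℕ → List ℕ
    multipliers Z k = filter (λ m → T? (any (fastExp (m * k) ≡ᵛ_) Z)) powers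

    -- The powers stored at exponent e′ - e are exactly those that, after a shift, move the ordered
    -- pair α^e, α^e′ to 1 and a member of `Z`.
    frames : List (V n₀) → Frames
    frames Z = proj₁ (build (multipliers Z) suc n₀ 0)

    -- N′ e + e′ is the exponent of the quotient of α^e′ by α^e.
    ratio : Frames → ℕ → ℕ → List ℕ
    ratio F e e′ = at F ((N′ * e + e′) % N)

    throughLines : Frames → List (List ℕ) → List (List ℕ)
    throughLines F = concatMap λ K → images K (logs (map fastExp K))
      where
      images : List ℕ → List ℕ → List (List ℕ)
      images K es = concatMap (λ e → concatMap (λ e′ → map (λ m → normalize e m K) (ratio F e e′)) es) es

    -- Multiplication is transitive on points, so lines through 1 suffice. On each of them some
    -- ordered pair must be movable to 1 and a member of `Z`. Since 1 is excluded from `Z`, such a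
    -- pair consists of different vectors.
    isTransversal : List (V n₀) → Frames → Bool
    isTransversal Z F = all (λ z → not (one ≡ᵛ z)) Z ∧ all hit (allVectors n₀)
      where
      hit : V n₀ → Bool
      hit y = (y ≡ᵛ 𝟘) ∨ (y ≡ᵛ one) ∨ any (λ e → any (λ e′ → not (null (ratio F e e′))) es) es
        where es = logs (one ∷ y ∷ [])

    countThrough : ∀ c → List (V n₀) → Trie → ℕ
    countThrough c bs t = length (through c (span bs) t)

    checkPoint : ℕ → ℕ → List (List ℕ) → Bool
    checkPoint c l R = countThrough c (one ∷ []) (trie spanExp (throughOne R)) ≡ᵇ l

    checkLines : ℕ → ℕ → List (V n₀) → Frames → List (List ℕ) → Bool
    checkLines c l Z F R = each (trie spanExp (throughLines F R))
      where
      each : Trie → Bool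
      each t = all (λ z → countThrough c (one ∷ z ∷ []) t ≡ᵇ l) Z

  expTable : Tree (V n₀)
  expTable = proj₁ (build id α n₀ one)

  logTable : LogTable n₀
  logTable = go N 0 one
    where
    go : ℕ → ℕ → V n₀ → LogTable n₀
    go zero       k x = ∅
    go (suc fuel) k x = record-log x k (go fuel (suc k) (α x))

  FieldCheck : Set
  FieldCheck = Computation.isField expTable logTable ≡ true

  TransversalCheck : List (V n₀) → Set
  TransversalCheck Z = check expTable logTable ≡ true
    where
    check : Tree (V n₀) → LogTable n₀ → Bool
    check E L = isTransversal Z (frames Z)
      where open Computation E L

  PointCheck : ℕ → ℕ → List (List ℕ) → Set
  PointCheck c l R = Computation.checkPoint expTable logTable c l R ≡ true

  LineCheck : ℕ → ℕ → List (V n₀) → List (List ℕ) → Set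
  LineCheck c l Z R = check expTable logTable ≡ true
    where
    check : Tree (V n₀) → LogTable n₀ → Bool
    check E L = checkLines c l Z (frames Z) R
      where open Computation E L

  -- With a and j unbounded, invariance under the group is immediate; the reduction to finitely many
  -- images is made in `Covers`.
  Orbits : List (List ℕ) → Pred (Sub n₀ c) 0ℓ
  Orbits R s = ∃ λ K → K ∈ R × ∃ λ a → ∃ λ j → ∀ x → x ∈ₛ s ⇔ x ∈⟨ map exp (affine a (μ ^ j) K) ⟩

  -- From the checks to counts for all points and lines

  module Verified (size : suc N ≡ 2 ^ n₀) (frobenius-order : μ ^ J ≡ suc N) (isField✓ : FieldCheck) where

    open Computation expTable logTable

    at-expTable : k < N → at expTable k ≡ exp k
    at-expTable {k} k<N = at-build id α n₀ one (subst (k <_) size (ℕ.m≤n⇒m≤1+n k<N))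

    private
      checks : T isPrimitive × T (isFrobenius φ-images) × T isLog
      checks = Prod.map₂ (∧⁻ {isFrobenius φ-images}) (∧⁻ {isPrimitive} (subst T (sym isField✓) tt))

    infix 4 _≈_
    -- Congruence modulo the order of α, expressed by powers so that no divisibility argument
    -- arises. Throughout, N′ = N - 1 plays the part of -1.
    _≈_ : ℕ → ℕ → Set
    a ≈ b = exp a ≡ exp b

    N≈0 : N ≈ 0
    N≈0 = trans (cong α (sym (trans (cong (at expTable) (m<n⇒m%n≡m (ℕ.n<1+n N′))) (at-expTable (ℕ.n<1+n N′)))))
                (≡ᵛ⇒≡ _ one (proj₁ checks))

    -- Composition of powers of α stands in for the product of the field, and commuting exponents
    -- for its commutativity.
    +-≈ : ∀ {a a′ b b′} → a ≈ a′ → b ≈ b′ → a + b ≈ a′ + b′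
    +-≈ {a} {a′} {b} {b′} p q = begin
      exp (a + b)       ≡⟨ iterate-+ α a b one ⟩
      pow a (exp b)     ≡⟨ cong (pow a) q ⟩
      pow a (exp b′)    ≡⟨ iterate-+ α a b′ one ⟨
      exp (a + b′)      ≡⟨ cong exp (ℕ.+-comm a b′) ⟩
      exp (b′ + a)      ≡⟨ iterate-+ α b′ a one ⟩
      pow b′ (exp a)    ≡⟨ cong (pow b′) p ⟩
      pow b′ (exp a′)   ≡⟨ iterate-+ α b′ a′ one ⟨
      exp (b′ + a′)     ≡⟨ cong exp (ℕ.+-comm b′ a′) ⟩
      exp (a′ + b′)     ∎
      where open ≡-Reasoning

    *-≈ʳ : ∀ m {a b} → a ≈ b → m * a ≈ m * b
    *-≈ʳ zero    p = refl
    *-≈ʳ (suc m) {a} {b} p = +-≈ {a} {b} {m * a} {m * b} p (*-≈ʳ m {a} {b} p)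

    *-≈ˡ : ∀ {a b} m → a ≈ b → a * m ≈ b * m
    *-≈ˡ {a} {b} m p = subst₂ _≈_ (ℕ.*-comm m a) (ℕ.*-comm m b) (*-≈ʳ m {a} {b} p)

    +*N≈ : ∀ a b → a + b * N ≈ a
    +*N≈ a b = trans (+-≈ {a} {a} {b * N} {b * 0} refl (*-≈ʳ b {N} {0} N≈0)) (cong exp (trans (cong (a +_) (ℕ.*-zeroʳ b)) (ℕ.+-identityʳ a)))

    %≈ : ∀ a → a % N ≈ a
    %≈ a = sym (trans (cong exp (m≡m%n+[m/n]*n a N)) (+*N≈ (a % N) (a / N)))

    fastExp≡exp : ∀ k → fastExp k ≡ exp k
    fastExp≡exp k = trans (at-expTable (m%n<n k N)) (%≈ k)

    map-fastExp : ∀ K → map fastExp K ≡ map exp K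
    map-fastExp = List.map-cong fastExp≡exp

    φ-exp : ∀ k → φ (exp k) ≡ exp (μ * k)
    φ-exp k = begin
      φ (exp k)              ≡⟨ cong φ (trans (fastExp≡exp (k % N)) (%≈ k)) ⟨
      φ (fastExp (k % N))    ≡⟨ ≡ᵛ⇒≡ _ _ (all-∈ (λ k → apply φ-images (fastExp k) ≡ᵛ fastExp (μ * k)) {upTo N}
                                  (proj₁ (proj₂ checks)) (∈-upTo⁺ (m%n<n k N))) ⟩
      fastExp (μ * (k % N))  ≡⟨ fastExp≡exp (μ * (k % N)) ⟩
      exp (μ * (k % N))      ≡⟨ *-≈ʳ μ {k % N} {k} (%≈ k) ⟩
      exp (μ * k)            ∎
      where open ≡-Reasoning

    exp-log : {v : V n₀} → v ≢ 𝟘 → exp (log logTable v) ≡ v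
    exp-log {v} ne with ∨⁻ {v ≡ᵛ 𝟘} (all-∈ (λ v → (v ≡ᵛ 𝟘) ∨ (fastExp (log logTable v) ≡ᵛ v))
                                            {allVectors n₀} (proj₂ (proj₂ checks)) (∈-allVectors v))
    ... | inj₁ p = contradiction (≡ᵛ⇒≡ v 𝟘 p) ne
    ... | inj₂ p = trans (sym (fastExp≡exp (log logTable v))) (≡ᵛ⇒≡ _ v p)

    one≢𝟘 : one ≢ 𝟘
    one≢𝟘 eq = nonzero n′ (trans eq (sym (𝟘-∷ʳ n′)))
      where
      𝟘-∷ʳ : ∀ n → 𝟘 {n} Vec.∷ʳ false ≡ 𝟘
      𝟘-∷ʳ zero    = refl
      𝟘-∷ʳ (suc n) = cong (false ∷_) (𝟘-∷ʳ n)
      nonzero : ∀ n → ¬ (𝟘 {n} Vec.∷ʳ true ≡ 𝟘 Vec.∷ʳ false)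
      nonzero n eq with () ← Vec.∷ʳ-injectiveʳ (𝟘 {n}) 𝟘 eq

    -- μ^J = N + 1 is congruent to 1, the exponent form of x^(2^n) = x.
    powers-order : ∀ q → μ ^ (q * J) ≈ 1
    powers-order zero    = refl
    powers-order (suc q) = begin
      exp (μ ^ (J + q * J))     ≡⟨ cong exp (ℕ.^-distribˡ-+-* μ J (q * J)) ⟩
      exp (μ ^ J * μ ^ (q * J)) ≡⟨ *-≈ʳ (μ ^ J) {μ ^ (q * J)} {1} (powers-order q) ⟩
      exp (μ ^ J * 1)           ≡⟨ cong exp (trans (ℕ.*-identityʳ (μ ^ J)) frobenius-order) ⟩
      exp (1 + N)               ≡⟨ +-≈ {1} {1} {N} {0} refl N≈0 ⟩
      exp 1                     ∎
      where open ≡-Reasoning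

    powers-% : ∀ j → μ ^ j ≈ μ ^ (j % J)
    powers-% j = begin
      exp (μ ^ j)                             ≡⟨ cong (λ i → exp (μ ^ i)) (m≡m%n+[m/n]*n j J) ⟩
      exp (μ ^ (j % J + j / J * J))           ≡⟨ cong exp (ℕ.^-distribˡ-+-* μ (j % J) (j / J * J)) ⟩
      exp (μ ^ (j % J) * μ ^ (j / J * J))     ≡⟨ *-≈ʳ (μ ^ (j % J)) {μ ^ (j / J * J)} {1} (powers-order (j / J)) ⟩
      exp (μ ^ (j % J) * 1)                   ≡⟨ cong exp (ℕ.*-identityʳ (μ ^ (j % J))) ⟩
      exp (μ ^ (j % J))                       ∎
      where open ≡-Reasoning

    act : ℕ → ℕ → V n₀ → V n₀
    act a j x = pow a (iterate φ j x)

    α-linear : Linear α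
    α-linear (a ∷ x) (b ∷ y) = begin
      ((x ⊕ y) Vec.∷ʳ false) ⊕ (a xor b) · taps                  ≡⟨ cong₂ _⊕_ (∷ʳ-⊕ x y) (xor-· a b taps) ⟩
      ((x Vec.∷ʳ false) ⊕ (y Vec.∷ʳ false)) ⊕ (a · taps ⊕ b · taps) ≡⟨ ⊕-interchange (x Vec.∷ʳ false) (y Vec.∷ʳ false) (a · taps) (b · taps) ⟩
      α (a ∷ x) ⊕ α (b ∷ y)                                      ∎
      where
      open ≡-Reasoning
      ∷ʳ-⊕ : ∀ {n} (x y : V n) → (x ⊕ y) Vec.∷ʳ false ≡ (x Vec.∷ʳ false) ⊕ (y Vec.∷ʳ false)
      ∷ʳ-⊕ []      []      = refl
      ∷ʳ-⊕ (a ∷ x) (b ∷ y) = cong (_ ∷_) (∷ʳ-⊕ x y)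

    act-linear : ∀ a j → Linear (act a j)
    act-linear a j x y = trans (cong (pow a) (iterate-linear (apply-linear φ-images) j x y))
                               (iterate-linear α-linear a _ _)

    act-exp : ∀ a j k → act a j (exp k) ≡ exp (a + μ ^ j * k)
    act-exp a j k = trans (cong (pow a) (φ-power j)) (sym (iterate-+ α a (μ ^ j * k) one))
      where
      φ-power : ∀ j → iterate φ j (exp k) ≡ exp (μ ^ j * k)
      φ-power zero    = cong exp (sym (ℕ.*-identityˡ k))
      φ-power (suc j) = trans (cong φ (φ-power j)) (trans (φ-exp (μ ^ j * k)) (cong exp (sym (ℕ.*-assoc μ (μ ^ j) k))))

    -- The inverse of x ↦ α^a φ^j(x) is x ↦ φ^(-j)(α^(-a) x), which has the shift -μ^(-j) a. Here J′
    -- j stands for the exponent -j.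
    invShift : ℕ → ℕ → ℕ
    invShift a j = N′ * (μ ^ (J′ * j) * a)

    private
      inverse-powers : ∀ j → μ ^ (J′ * j) * μ ^ j ≈ 1
      inverse-powers j = trans (cong exp (trans (sym (ℕ.^-distribˡ-+-* μ (J′ * j) j))
        (cong (μ ^_) (trans (ℕ.+-comm (J′ * j) j) (ℕ.*-comm J j))))) (powers-order j)

      -- Every nonzero vector is a power of α, so the inverse laws reduce to arithmetic of
      -- exponents.
      fix-exp : {f : V n₀ → V n₀} → Linear f → (∀ k → f (exp k) ≡ exp k) → ∀ x → f x ≡ x
      fix-exp {f} lin h x with Vec.≡-dec Bool._≟_ x 𝟘
      ... | yes refl = linear-𝟘 lin
      ... | no ne    = trans (cong f (sym (exp-log ne))) (trans (h (log logTable x)) (exp-log ne))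

      inv-fun-exp : ∀ a j k → act (invShift a j) (J′ * j) (act a j (exp k)) ≡ exp k
      inv-fun-exp a j k = begin
        act (invShift a j) (J′ * j) (act a j (exp k))   ≡⟨ cong (act (invShift a j) (J′ * j)) (act-exp a j k) ⟩
        act (invShift a j) (J′ * j) (exp (a + p * k))   ≡⟨ act-exp (invShift a j) (J′ * j) (a + p * k) ⟩
        exp (N′ * (p′ * a) + p′ * (a + p * k))          ≡⟨ cong exp (regroup N′ p p′ a k) ⟩
        exp ((p′ * p) * k + (p′ * a) * N)               ≡⟨ +*N≈ (p′ * p * k) (p′ * a) ⟩
        exp ((p′ * p) * k)                              ≡⟨ *-≈ˡ {p′ * p} {1} k (inverse-powers j) ⟩
        exp (1 * k)                                     ≡⟨ cong exp (ℕ.*-identityˡ k) ⟩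
        exp k                                           ∎
        where
        open ≡-Reasoning
        p = μ ^ j
        p′ = μ ^ (J′ * j)
        regroup : ∀ N′ p p′ a k → N′ * (p′ * a) + p′ * (a + p * k) ≡ (p′ * p) * k + (p′ * a) * suc N′
        regroup = solve-∀

      fun-inv-exp : ∀ a j k → act a j (act (invShift a j) (J′ * j) (exp k)) ≡ exp k
      fun-inv-exp a j k = begin
        act a j (act (invShift a j) (J′ * j) (exp k))   ≡⟨ cong (act a j) (act-exp (invShift a j) (J′ * j) k) ⟩
        act a j (exp (N′ * (p′ * a) + p′ * k))          ≡⟨ act-exp a j (N′ * (p′ * a) + p′ * k) ⟩
        exp (a + p * (N′ * (p′ * a) + p′ * k))          ≡⟨ cong exp (regroup N′ p p′ a k) ⟩
        exp (a + (p′ * p) * (N′ * a + k))               ≡⟨ +-≈ {a} {a} {p′ * p * (N′ * a + k)} {1 * (N′ * a + k)} refl (*-≈ˡ {p′ * p} {1} (N′ * a + k) (inverse-powers j)) ⟩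
        exp (a + 1 * (N′ * a + k))                      ≡⟨ cong exp (regroup′ N′ a k) ⟩
        exp (k + a * N)                                 ≡⟨ +*N≈ k a ⟩
        exp k                                           ∎
        where
        open ≡-Reasoning
        p = μ ^ j
        p′ = μ ^ (J′ * j)
        regroup : ∀ N′ p p′ a k → a + p * (N′ * (p′ * a) + p′ * k) ≡ a + (p′ * p) * (N′ * a + k)
        regroup = solve-∀
        regroup′ : ∀ N′ a k → a + 1 * (N′ * a + k) ≡ k + a * suc N′
        regroup′ = solve-∀

    linear-∘ : {f g : V n₀ → V n₀} → Linear f → Linear g → Linear (f ∘ g)
    linear-∘ {f} p q x y = trans (cong f (q x y)) (p _ _)

    iso : ℕ → ℕ → LinearIso n₀
    iso a j = record
      { fun        = act a j
      ; inv        = act (invShift a j) (J′ * j)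
      ; fun-linear = act-linear a j
      ; inv-linear = act-linear (invShift a j) (J′ * j)
      ; fun-inv    = fix-exp (linear-∘ (act-linear a j) (act-linear (invShift a j) (J′ * j))) (fun-inv-exp a j)
      ; inv-fun    = fix-exp (linear-∘ (act-linear (invShift a j) (J′ * j)) (act-linear a j)) (inv-fun-exp a j)
      }

    map-act-exp : ∀ a j K → map (act a j) (map exp K) ≡ map exp (affine a (μ ^ j) K)
    map-act-exp a j K = begin
      map (act a j) (map exp K)       ≡⟨ List.map-∘ K ⟨
      map (act a j ∘ exp) K           ≡⟨ List.map-cong (act-exp a j) K ⟩
      map (λ k → exp (a + μ ^ j * k)) K ≡⟨ List.map-∘ K ⟩
      map exp (affine a (μ ^ j) K)    ∎
      where open ≡-Reasoning

    affine-affine : ∀ a j b i K → affine a (μ ^ j) (affine b (μ ^ i) K) ≡ affine (a + μ ^ j * b) (μ ^ (j + i)) K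
    affine-affine a j b i K = trans (sym (List.map-∘ K)) (List.map-cong pointwise K)
      where
      regroup : ∀ a m b m′ k → a + m * (b + m′ * k) ≡ a + m * b + m * m′ * k
      regroup = solve-∀
      pointwise : ∀ k → a + μ ^ j * (b + μ ^ i * k) ≡ a + μ ^ j * b + μ ^ (j + i) * k
      pointwise k = trans (regroup a (μ ^ j) b (μ ^ i) k)
                          (cong (λ m → a + μ ^ j * b + m * k) (sym (ℕ.^-distribˡ-+-* μ j i)))

    to-one : ∀ {u} → u ≢ 𝟘 → act (N′ * log logTable u) 0 u ≡ one
    to-one {u} u≢𝟘 = begin
      pow (N′ * a) u            ≡⟨ cong (pow (N′ * a)) (exp-log u≢𝟘) ⟨
      pow (N′ * a) (exp a)      ≡⟨ iterate-+ α (N′ * a) a one ⟨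
      exp (N′ * a + a)          ≡⟨ cong exp (trans (ℕ.+-comm (N′ * a) a) (ℕ.*-comm N a)) ⟩
      exp (0 + a * N)           ≡⟨ +*N≈ 0 a ⟩
      one                       ∎
      where
      open ≡-Reasoning
      a = log logTable u

    -- Two different nonzero vectors of a line span it, so a reduction may use whichever pair of the
    -- line reaches `Z`.
    same-line : ∀ {x y v v′} → v ∈ nonzeroSpan (x ∷ y ∷ []) → v′ ∈ nonzeroSpan (x ∷ y ∷ []) → v ≢ v′ →
                (s : Sub n₀ c) → (v ∈ₛ s × v′ ∈ₛ s) ⇔ (x ∈ₛ s × y ∈ₛ s)
    same-line {x = x} {y} p q ne s = mk⇔ (λ (a , b) → forth p q ne a b) (λ (a , b) → each p a b , each q a b)
      where
      each : ∀ {v} → v ∈ nonzeroSpan (x ∷ y ∷ []) → x ∈ₛ s → y ∈ₛ s → v ∈ₛ s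
      each (here refl)                 a b = a
      each (there (here refl))         a b = b
      each (there (there (here refl))) a b = ∈ₛ-⊕ s a b

      left : x ⊕ y ∈ₛ s → y ∈ₛ s → x ∈ₛ s
      left a b = ∈ₛ-cancel s b (subst (_∈ₛ s) (⊕-comm x y) a)

      forth : ∀ {v v′} → v ∈ nonzeroSpan (x ∷ y ∷ []) → v′ ∈ nonzeroSpan (x ∷ y ∷ []) → v ≢ v′ →
              v ∈ₛ s → v′ ∈ₛ s → x ∈ₛ s × y ∈ₛ s
      forth (here refl)                 (here refl)                 ne a b = contradiction refl ne
      forth (here refl)                 (there (here refl))         ne a b = a , b
      forth (here refl)                 (there (there (here refl))) ne a b = a , ∈ₛ-cancel s a b
      forth (there (here refl))         (here refl)                 ne a b = b , a
      forth (there (here refl))         (there (here refl))         ne a b = contradiction refl ne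
      forth (there (here refl))         (there (there (here refl))) ne a b = left b a , a
      forth (there (there (here refl))) (here refl)                 ne a b = b , ∈ₛ-cancel s b a
      forth (there (there (here refl))) (there (here refl))         ne a b = left a b , b
      forth (there (there (here refl))) (there (there (here refl))) ne a b = contradiction refl ne

    module _ (R : List (List ℕ)) where

      -- A preimage under g is an image under its inverse, again of the form α^a φ^j. With g
      -- arbitrary, one proof serves `iso a j` and its inverse.
      orbits-preimage⁺ : (g : LinearIso n₀) (a j : ℕ) → (∀ x → inv g x ≡ act a j x) →
                         (s : Sub n₀ c) → Orbits R s → Orbits R (preimage g s)
      orbits-preimage⁺ g a j eq s (K , K∈R , b , i , e) =
        K , K∈R , a + μ ^ j * b , j + i , λ x → mk⇔
          (subst (x ∈⟨_⟩) images ∘ from (∈-map-inv g _) ∘ to (e _) ∘ to (∈-preimage g s x))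
          (from (∈-preimage g s x) ∘ from (e _) ∘ to (∈-map-inv g _) ∘ subst (x ∈⟨_⟩) (sym images))
        where
        images : map (inv g) (map exp (affine b (μ ^ i) K)) ≡ map exp (affine (a + μ ^ j * b) (μ ^ (j + i)) K)
        images = trans (List.map-cong eq (map exp (affine b (μ ^ i) K)))
          (trans (map-act-exp a j (affine b (μ ^ i) K)) (cong (map exp) (affine-affine a j b i K)))

      orbits-preimage : ∀ a j (s : Sub n₀ c) → Orbits R s ⇔ Orbits R (preimage (iso a j) s)
      orbits-preimage a j s = mk⇔
        (orbits-preimage⁺ (iso a j) (invShift a j) (J′ * j) (λ _ → refl) s)
        (subst (Orbits R) (preimage-sym (iso a j) s) ∘
          orbits-preimage⁺ (iso-sym (iso a j)) a j (λ _ → refl) (preimage (iso a j) s))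

      card-point : ∀ a j {u} → Card (ThroughPoint (Orbits {c} R) (act a j u)) l → Card (ThroughPoint (Orbits {c} R) u) l
      card-point a j {u} = card-preimage (iso a j) λ s → mk⇔
        (λ (p , q) → to (orbits-preimage a j s) p , from (∈-preimage (iso a j) s u) q)
        (λ (p , q) → from (orbits-preimage a j s) p , to (∈-preimage (iso a j) s u) q)

      card-line : ∀ a j {u w} → Card (ThroughLine (Orbits {c} R) (act a j u) (act a j w)) l →
                  Card (ThroughLine (Orbits {c} R) u w) l
      card-line a j {u} {w} = card-preimage (iso a j) λ s → mk⇔
        (λ (p , q , r) → to (orbits-preimage a j s) p , from (∈-preimage (iso a j) s u) q , from (∈-preimage (iso a j) s w) r)
        (λ (p , q , r) → from (orbits-preimage a j s) p , to (∈-preimage (iso a j) s u) q , to (∈-preimage (iso a j) s w) r)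

      Images : List (List ℕ) → Set
      Images L = ∀ {K′} → K′ ∈ L → ∃ λ K → K ∈ R × ∃ λ a → ∃ λ j → K′ ≡ affine a (μ ^ j) K

      Covers : ℕ → List (List ℕ) → List (V n₀) → Set
      Covers c L bs = ∀ {s : Sub n₀ c} → Orbits R s → (∀ {b} → b ∈ bs → b ∈ₛ s) →
                      ∃ λ K′ → K′ ∈ L × (∀ x → x ∈ₛ s ⇔ x ∈⟨ map exp K′ ⟩)

      -- By `Images` the trie holds only blocks, by `Covers` all blocks through `bs`; entries that
      -- miss `bs` are dropped by `through`.
      card-through : ∀ L bs → Images L → Covers c L bs → T (countThrough c bs (trie spanExp L) ≡ᵇ l) →
                     Card (λ (s : Sub n₀ c) → Orbits R s × (∀ {b} → b ∈ bs → b ∈ₛ s)) l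
      card-through {c} {l} L bs images covers count = record
        { list     = through c (span bs) (trie spanExp L)
        ; unique   = through-unique c (span bs) (trie spanExp L)
        ; sound    = sound′
        ; complete = λ {s} (o , p) → ∈-through⁺ (span bs) {trie spanExp L} {s} (λ q → ∈⟨⟩-⊆ s p (to (∈-span bs) q)) (member′ {s} o p)
        ; size     = ℕ.≡ᵇ⇒≡ _ l count
        }
        where
        ∈-spanExp : ∀ K x → x ∈ₚ spanExp K ⇔ x ∈⟨ map exp K ⟩
        ∈-spanExp K x = subst (λ bs → x ∈ₚ spanExp K ⇔ x ∈⟨ bs ⟩) (map-fastExp K) (∈-span (map fastExp K))

        sound′ : ∀ {s} → s ∈ through c (span bs) (trie spanExp L) → Orbits R s × (∀ {b} → b ∈ bs → b ∈ₛ s)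
        sound′ {s} p with q , r ← ∈-through⁻ (span bs) {trie spanExp L} {s} p
          with K′ , K′∈L , eq ← ∈-trie⁻ spanExp L {s} r
          with K , K∈R , a , j , refl ← images K′∈L =
          (K , K∈R , a , j , λ x → subst (λ w → x ∈ₚ w ⇔ x ∈⟨ map exp (affine a (μ ^ j) K) ⟩) eq (∈-spanExp _ x))
          , λ b∈bs → q (from (∈-span bs) (∈⇒∈⟨⟩ b∈bs))

        member′ : ∀ {s} → Orbits R s → (∀ {b} → b ∈ bs → b ∈ₛ s) → T (s ∈ₜ trie spanExp L)
        member′ {s} o p with K′ , K′∈L , e ← covers {s} o p =
          ∈-trie⁺ spanExp {s = s} K′∈L (≡-by-members (proj₂ (spanExp K′)) s
            (λ x → from (e x) ∘ to (∈-spanExp K′ x)) (λ x → from (∈-spanExp K′ x) ∘ to (e x)))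

      member-log : ∀ K b i {z} → z ∈⟨ map exp (affine b (μ ^ i) K) ⟩ → z ≢ 𝟘 →
                   ∃ λ e → e ∈ logs (map fastExp K) × exp (b + μ ^ i * e) ≡ z
      member-log K b i {z} p ne
        with y , q , eq ← ∈⟨⟩-map⁻ (act-linear b i) (map exp K) (subst (z ∈⟨_⟩) (sym (map-act-exp b i K)) p) =
        log logTable y
        , ∈-map⁺ (log logTable) (subst (λ bs → y ∈ nonzeroSpan bs) (sym (map-fastExp K)) (∈-nonzeroSpan (map exp K) q y≢𝟘))
        , trans (sym (act-exp b i _)) (trans (cong (act b i) (exp-log y≢𝟘)) eq)
        where
        y≢𝟘 : y ≢ 𝟘
        y≢𝟘 y≡𝟘 = ne (trans (sym eq) (trans (cong (act b i) y≡𝟘) (linear-𝟘 (act-linear b i))))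

      module _ {b i e : ℕ} (at-one : exp (b + μ ^ i * e) ≡ one) where
        private
          p = μ ^ i
          p′ = μ ^ (i % J)

        -- From α^(b + p e) = 1 the shift b is congruent to -p e. So a block through 1 is determined
        -- by K, e and i modulo J.
        normalized : ∀ k → p′ * (N′ * e + k) ≈ b + p * k
        normalized k = begin
          exp (p′ * (N′ * e + k))                  ≡⟨ *-≈ˡ {p} {p′} (N′ * e + k) (powers-% i) ⟨
          exp (p * (N′ * e + k))                   ≡⟨ +-≈ {0} {b + p * e} {p * (N′ * e + k)} {p * (N′ * e + k)} (sym at-one) refl ⟩
          exp ((b + p * e) + p * (N′ * e + k))     ≡⟨ cong exp (regroup N′ b p e k) ⟩
          exp ((b + p * k) + (p * e) * N)          ≡⟨ +*N≈ (b + p * k) (p * e) ⟩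
          exp (b + p * k)                          ∎
          where
          open ≡-Reasoning
          regroup : ∀ N′ b p e k → (b + p * e) + p * (N′ * e + k) ≡ (b + p * k) + (p * e) * suc N′
          regroup = solve-∀

        map-exp-normalize : ∀ K → map exp (normalize e p′ K) ≡ map exp (affine b p K)
        map-exp-normalize K = trans (sym (List.map-∘ K)) (trans (List.map-cong pointwise K) (List.map-∘ K))
          where
          pointwise : ∀ k → p′ * (N′ * e) + p′ * k ≈ b + p * k
          pointwise k = trans (cong exp (sym (ℕ.*-distribˡ-+ p′ (N′ * e) k))) (normalized k)

      ∈-powers : ∀ i → μ ^ (i % J) ∈ powers
      ∈-powers i = ∈-map⁺ (μ ^_) (∈-upTo⁺ (m%n<n i J))

      image-normalize : ∀ {K e m} → K ∈ R → m ∈ powers → ∃ λ K₀ → K₀ ∈ R × ∃ λ a → ∃ λ j → normalize e m K ≡ affine a (μ ^ j) K₀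
      image-normalize {K} {e} K∈R m∈ with j , _ , refl ← ∈-map⁻ (μ ^_) {xs = upTo J} m∈ = K , K∈R , μ ^ j * (N′ * e) , j , refl

      images-throughOne : Images (throughOne R)
      images-throughOne p
        with K , K∈R , q ← find (∈-concatMap⁻ _ {xs = R} p)
        with e , _ , r ← find (∈-concatMap⁻ (λ e → map (λ m → normalize e m K) powers) {xs = logs (map fastExp K)} q)
        with m , m∈ , refl ← ∈-map⁻ (λ m → normalize e m K) r = image-normalize {e = e} K∈R m∈

      covers-throughOne : Covers c (throughOne R) (one ∷ [])
      covers-throughOne {s = s} (K , K∈R , b , i , e) p
        with k , k∈ , eq ← member-log K b i (to (e one) (p (here refl))) one≢𝟘 =
        normalize k (μ ^ (i % J)) K
        , ∈-concatMap⁺ _ (lose K∈R (∈-concatMap⁺ (λ e → map (λ m → normalize e m K) powers)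
            (lose k∈ (∈-map⁺ (λ m → normalize k m K) (∈-powers i)))))
        , λ x → subst (λ bs → x ∈ₛ s ⇔ x ∈⟨ bs ⟩) (sym (map-exp-normalize {b} {i} {k} eq K)) (e x)

      points : PointCheck c l R → ∀ {u} → u ≢ 𝟘 → Card (ThroughPoint (Orbits {c} R) u) l
      points check {u} u≢𝟘 = card-point (N′ * a) 0 (subst (λ v → Card (ThroughPoint (Orbits R) v) _) (sym (to-one u≢𝟘))
        (card-⇔ (λ s → mk⇔ (λ (o , p) → o , p (here refl)) (λ (o , p) → o , λ { (here refl) → p }))
          (card-through (throughOne R) (one ∷ []) images-throughOne (λ {s} → covers-throughOne {s = s}) (subst T (sym check) tt))))
        where a = log logTable u

      module _ (Z : List (V n₀)) where

        ∈-multipliers : ∀ k {m′} → m′ ∈ multipliers Z k → ∃ λ j → m′ ≡ μ ^ j × exp (m′ * k) ∈ Z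
        ∈-multipliers k p with q , r ← ∈-filter⁻ (λ m → T? (any (fastExp (m * k) ≡ᵛ_) Z)) {xs = powers} p
          with j , _ , refl ← ∈-map⁻ (μ ^_) {xs = upTo J} q
          with z , z∈Z , t ← any-∈ (fastExp (μ ^ j * k) ≡ᵛ_) Z r =
          j , refl , subst (_∈ Z) (trans (sym (≡ᵛ⇒≡ _ z t)) (fastExp≡exp (μ ^ j * k))) z∈Z

        ratio-multipliers : ∀ e e′ → ratio (frames Z) e e′ ≡ multipliers Z ((N′ * e + e′) % N)
        ratio-multipliers e e′ = trans
          (at-build (multipliers Z) suc n₀ 0 (subst ((N′ * e + e′) % N <_) size (ℕ.m≤n⇒m≤1+n (m%n<n (N′ * e + e′) N))))
          (cong (multipliers Z) (count ((N′ * e + e′) % N)))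
          where
          count : ∀ k → iterate suc k 0 ≡ k
          count zero    = refl
          count (suc k) = cong suc (count k)

        ratio⁻ : ∀ e e′ {m′} → m′ ∈ ratio (frames Z) e e′ → ∃ λ j → m′ ≡ μ ^ j × exp (m′ * (N′ * e + e′)) ∈ Z
        ratio⁻ e e′ {m′} p with j , eq , q ← ∈-multipliers ((N′ * e + e′) % N) (subst (m′ ∈_) (ratio-multipliers e e′) p) =
          j , eq , subst (_∈ Z) (*-≈ʳ m′ {(N′ * e + e′) % N} {N′ * e + e′} (%≈ (N′ * e + e′))) q

        ratio⁺ : ∀ e e′ i → exp (μ ^ (i % J) * (N′ * e + e′)) ∈ Z → μ ^ (i % J) ∈ ratio (frames Z) e e′
        ratio⁺ e e′ i q = subst (_ ∈_) (sym (ratio-multipliers e e′))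
          (∈-filter⁺ (λ m → T? (any (fastExp (m * q₀) ≡ᵛ_) Z)) (∈-powers i)
            (Any.any⁺ (fastExp (μ ^ (i % J) * q₀) ≡ᵛ_) (lose (subst (_∈ Z) (sym eq) q) (≡ᵛ-refl (fastExp (μ ^ (i % J) * q₀))))))
          where
          q₀ = (N′ * e + e′) % N
          eq : fastExp (μ ^ (i % J) * q₀) ≡ exp (μ ^ (i % J) * (N′ * e + e′))
          eq = trans (fastExp≡exp (μ ^ (i % J) * q₀)) (*-≈ʳ (μ ^ (i % J)) {q₀} {N′ * e + e′} (%≈ (N′ * e + e′)))

        private
          L = throughLines (frames Z) R

          fromPair : List ℕ → ℕ → ℕ → List (List ℕ)
          fromPair K e e′ = map (λ m → normalize e m K) (ratio (frames Z) e e′)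

        images-throughLines : Images L
        images-throughLines p
          with K , K∈R , q ← find (∈-concatMap⁻ _ {xs = R} p)
          with e , _ , r ← find (∈-concatMap⁻ (λ e → concatMap (fromPair K e) (logs (map fastExp K))) {xs = logs (map fastExp K)} q)
          with e′ , _ , t ← find (∈-concatMap⁻ (fromPair K e) {xs = logs (map fastExp K)} r)
          with m′ , m′∈ , refl ← ∈-map⁻ (λ m → normalize e m K) t
          with j , refl , _ ← ratio⁻ e e′ m′∈ = K , K∈R , μ ^ j * (N′ * e) , j , refl

        -- If α^e and α^e′ go to 1 and z under the Frobenius power m and a shift, then z = α^(m (e′
        -- - e)). So m is stored at the ratio of the pair, and the block is listed.
        covers-throughLines : ∀ {z} → z ∈ Z → z ≢ 𝟘 → Covers c L (one ∷ z ∷ [])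
        covers-throughLines {z = z} z∈Z z≢𝟘 {s} (K , K∈R , b , i , E) p
          with e , e∈ , eq ← member-log K b i (to (E one) (p (here refl))) one≢𝟘
          with e′ , e′∈ , eq′ ← member-log K b i (to (E z) (p (there (here refl)))) z≢𝟘 =
          normalize e (μ ^ (i % J)) K
          , ∈-concatMap⁺ _ (lose K∈R (∈-concatMap⁺ (λ e → concatMap (fromPair K e) (logs (map fastExp K)))
              (lose e∈ (∈-concatMap⁺ (fromPair K e) (lose e′∈ (∈-map⁺ (λ m → normalize e m K)
                (ratio⁺ e e′ i (subst (_∈ Z) (sym (trans (normalized {b} {i} {e} eq e′) eq′)) z∈Z))))))))
          , λ x → subst (λ bs → x ∈ₛ s ⇔ x ∈⟨ bs ⟩) (sym (map-exp-normalize {b} {i} {e} eq K)) (E x)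

        ratio-pair : ∀ bs → T (any (λ e → any (λ e′ → not (null (ratio (frames Z) e e′))) (logs bs)) (logs bs)) →
                     ∃ λ v → ∃ λ v′ → v ∈ nonzeroSpan bs × v′ ∈ nonzeroSpan bs ×
                       ∃ λ j → exp (μ ^ j * (N′ * log logTable v + log logTable v′)) ∈ Z
        ratio-pair bs t
          with e , e∈ , t ← any-∈ (λ e → any (λ e′ → not (null (ratio (frames Z) e e′))) (logs bs)) (logs bs) t
          with e′ , e′∈ , t ← any-∈ (λ e′ → not (null (ratio (frames Z) e e′))) (logs bs) t
          with m′ , m′∈ ← nonempty-∈ (ratio (frames Z) e e′) t
          with v , v∈ , refl ← ∈-map⁻ (log logTable) {xs = nonzeroSpan bs} e∈
          with v′ , v′∈ , refl ← ∈-map⁻ (log logTable) {xs = nonzeroSpan bs} e′∈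
          with j , refl , z∈Z ← ratio⁻ (log logTable v) (log logTable v′) m′∈ = v , v′ , v∈ , v′∈ , j , z∈Z

        line-one : TransversalCheck Z → LineCheck c l Z R →
                   ∀ {z} → z ∈ Z → z ≢ 𝟘 → Card (ThroughLine (Orbits {c} R) one z) l
        line-one {c} {l} transversal check {z} z∈Z z≢𝟘 =
          card-⇔ (λ s → mk⇔ (λ (o , p) → o , p (here refl) , p (there (here refl)))
              (λ (o , p , q) → o , λ { (here refl) → p ; (there (here refl)) → q }))
            (card-through L (one ∷ z ∷ []) images-throughLines (λ {s} → covers-throughLines z∈Z z≢𝟘 {s})
              (all-∈ (λ z → countThrough c (one ∷ z ∷ []) (trie spanExp L) ≡ᵇ l) {Z} (subst T (sym check) tt) z∈Z))

        one∉Z : TransversalCheck Z → ∀ {z} → z ∈ Z → one ≢ z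
        one∉Z transversal z∈Z refl = subst T (to Bool.T-not-≡ differs) (≡ᵛ-refl one)
          where
          differs : T (not (one ≡ᵛ one))
          differs = all-∈ (λ z → not (one ≡ᵛ z)) {Z} (proj₁ (∧⁻ (subst T (sym transversal) tt))) z∈Z

        -- Division by v followed by φ^j takes v to 1 and v′ into `Z`; written as α^a φ^j, its shift
        -- is -μ^j e. As 1 is not in `Z`, v and v′ differ.
        line-frame : TransversalCheck Z → LineCheck c l Z R → ∀ v v′ j → v ≢ 𝟘 → v′ ≢ 𝟘 →
                     exp (μ ^ j * (N′ * log logTable v + log logTable v′)) ∈ Z →
                     v ≢ v′ × Card (ThroughLine (Orbits {c} R) v v′) l
        line-frame {c} {l} transversal check v v′ j v≢𝟘 v′≢𝟘 z∈Z =
          (λ eq → one∉Z transversal z∈Z (trans (sym v↦one) (trans (cong (act a j) eq) v′↦z)))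
          , card-line a j (subst₂ (λ x z → Card (ThroughLine (Orbits R) x z) l) (sym v↦one) (sym v′↦z)
              (line-one transversal check z∈Z z≢𝟘))
          where
          e = log logTable v
          e′ = log logTable v′
          a = μ ^ j * (N′ * e)
          z = exp (μ ^ j * (N′ * e + e′))

          v′↦z : act a j v′ ≡ z
          v′↦z = trans (cong (act a j) (sym (exp-log v′≢𝟘))) (trans (act-exp a j e′)
            (cong exp (sym (ℕ.*-distribˡ-+ (μ ^ j) (N′ * e) e′))))

          regroup : ∀ N′ p e → p * (N′ * e) + p * e ≡ p * e * suc N′
          regroup = solve-∀

          v↦one : act a j v ≡ one
          v↦one = trans (cong (act a j) (sym (exp-log v≢𝟘))) (trans (act-exp a j e)
            (trans (cong exp (regroup N′ (μ ^ j) e)) (+*N≈ 0 (μ ^ j * e))))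

          z≢𝟘 : z ≢ 𝟘
          z≢𝟘 eq = v′≢𝟘 (trans (sym (inv-fun (iso a j) v′))
            (trans (cong (inv (iso a j)) (trans v′↦z eq)) (linear-𝟘 (inv-linear (iso a j)))))

        -- Two moves: division by `u` brings the line through 1, and the transversal then supplies a
        -- pair on it that goes to 1 and a member of `Z`.
        lines : TransversalCheck Z → LineCheck c l Z R →
                ∀ {u w} → u ≢ 𝟘 → w ≢ 𝟘 → u ≢ w → Card (ThroughLine (Orbits {c} R) u w) l
        lines {c} {l} transversal check {u} {w} u≢𝟘 w≢𝟘 u≢w = card-line a₁ 0
          (subst (λ v → Card (ThroughLine (Orbits R) v y) l) (sym (to-one u≢𝟘)) (line-one-y (hit⁻ (∨⁻ {y ≡ᵛ 𝟘} hit))))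
          where
          a₁ = N′ * log logTable u
          y = act a₁ 0 w

          injective : ∀ {v v′} → act a₁ 0 v ≡ act a₁ 0 v′ → v ≡ v′
          injective {v} {v′} eq = trans (sym (inv-fun (iso a₁ 0) v)) (trans (cong (inv (iso a₁ 0)) eq) (inv-fun (iso a₁ 0) v′))

          y≢𝟘 : y ≢ 𝟘
          y≢𝟘 eq = w≢𝟘 (injective (trans eq (sym (linear-𝟘 (act-linear a₁ 0)))))

          one≢y : one ≢ y
          one≢y eq = u≢w (injective (trans (to-one u≢𝟘) eq))

          es = logs (one ∷ y ∷ [])
          pair : ℕ → ℕ → Bool
          pair e e′ = not (null (ratio (frames Z) e e′))

          hit : T ((y ≡ᵛ 𝟘) ∨ (y ≡ᵛ one) ∨ any (λ e → any (pair e) es) es)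
          hit = all-∈ _ {allVectors n₀} (proj₂ (∧⁻ {all (λ z → not (one ≡ᵛ z)) Z} (subst T (sym transversal) tt))) (∈-allVectors y)

          hit⁻ : T (y ≡ᵛ 𝟘) ⊎ T ((y ≡ᵛ one) ∨ any (λ e → any (pair e) es) es) → T (any (λ e → any (pair e) es) es)
          hit⁻ (inj₁ t) = contradiction (≡ᵛ⇒≡ y 𝟘 t) y≢𝟘
          hit⁻ (inj₂ t) with ∨⁻ {y ≡ᵛ one} t
          ... | inj₁ t = contradiction (sym (≡ᵛ⇒≡ y one t)) one≢y
          ... | inj₂ t = t

          nonzero : ∀ {v} → v ∈ nonzeroSpan (one ∷ y ∷ []) → v ≢ 𝟘
          nonzero (here refl)                 = one≢𝟘
          nonzero (there (here refl))         = y≢𝟘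
          nonzero (there (there (here refl))) = one≢y ∘ ⊕≡𝟘⇒≡ one y

          line-one-y : T (any (λ e → any (pair e) es) es) → Card (ThroughLine (Orbits R) one y) l
          line-one-y t =
            let v , v′ , v∈ , v′∈ , j , z∈Z = ratio-pair (one ∷ y ∷ []) t
                v≢v′ , C = line-frame transversal check v v′ j (nonzero v∈) (nonzero v′∈) z∈Z
            in card-⇔ (λ s → mk⇔ (λ (o , p) → o , to (same-line v∈ v′∈ v≢v′ s) p)
                                 (λ (o , p) → o , from (same-line v∈ v′∈ v≢v′ s) p)) C

-- The fields, the line representatives and the orbit representatives

-- Exponents of bases of subspaces through 1 = α^0.
plane : ℕ × ℕ → List ℕ
plane (a , b) = 0 ∷ a ∷ b ∷ []

solid : ℕ × ℕ × ℕ → List ℕ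
solid (a , b , c) = 0 ∷ a ∷ b ∷ c ∷ []

-- GF(2^7), modulo x^7 + x + 1, with the group {α^k} alone: 2^7 is the multiplier of the identity.
module GF128 where

  open Orbits (false ∷ false ∷ false ∷ false ∷ false ∷ true ∷ true ∷ []) 126 128 0 public

  -- The group acts freely on points, so the stabilizer of a line has order dividing both 3 and 127.
  -- Hence the 2667 lines form 2667 / 127 = 21 orbits.
  transversal : List (V 7)
  transversal = map exp
    (1 ∷ 2 ∷ 3 ∷ 4 ∷ 5 ∷ 8 ∷ 9 ∷ 10 ∷ 11 ∷ 13 ∷ 15 ∷ 17 ∷ 18 ∷ 20 ∷ 21 ∷ 22 ∷ 23 ∷ 27 ∷ 30 ∷ 33 ∷ 34 ∷ [])

  transversal✓ : TransversalCheck transversal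
  transversal✓ = refl

  field✓ : FieldCheck
  field✓ = refl

  open Verified refl refl field✓ public

-- Modulo x^9 + x^4 + 1.
taps₉ : V 9
taps₉ = false ∷ false ∷ false ∷ false ∷ true ∷ false ∷ false ∷ false ∷ true ∷ []

-- GF(2^9) with the automorphism x ↦ x^8 of order 3.
module GF512₈ where

  open Orbits taps₉ 510 8 2 public

  -- The multiplicative group has 43435 / 511 = 85 orbits of lines; up to x ↦ x^8 these 31 represent
  -- them all.
  transversal : List (V 9)
  transversal = map exp
    (1 ∷ 2 ∷ 3 ∷ 4 ∷ 6 ∷ 7 ∷ 11 ∷ 12 ∷ 13 ∷ 14 ∷ 17 ∷ 19 ∷ 21 ∷ 23 ∷ 26 ∷ 27 ∷ 28 ∷ 33 ∷ 34 ∷ 35 ∷ 38 ∷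
     39 ∷ 45 ∷ 46 ∷ 49 ∷ 51 ∷ 53 ∷ 54 ∷ 73 ∷ 78 ∷ 98 ∷ [])

  transversal✓ : TransversalCheck transversal
  transversal✓ = refl

  field✓ : FieldCheck
  field✓ = refl

  open Verified refl refl field✓ public

-- GF(2^9) with the automorphism x ↦ x^2 of order 9.
module GF512₂ where

  open Orbits taps₉ 510 2 8 public

  -- A line lies in 2667 4-spaces, as against 127 3-spaces, so the solids profit most from a larger
  -- group, with 11 lines to test.
  transversal : List (V 9)
  transversal = map exp (1 ∷ 3 ∷ 7 ∷ 11 ∷ 17 ∷ 19 ∷ 21 ∷ 23 ∷ 27 ∷ 35 ∷ 73 ∷ [])

  transversal✓ : TransversalCheck transversal
  transversal✓ = refl

  field✓ : FieldCheck
  field✓ = refl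

  open Verified refl refl field✓ public

-- The subscript c of an orbit list says that the planes are the blocks of a 2-(n,3,c)₂ design and
-- the solids those of a 2-(n,4,5c)₂ design (n = 7) or a 2-(n,4,21c)₂ design (n = 9).  For equal n
-- the lists are disjoint, so their unions are designs as well.
planes₃ : List (ℕ × ℕ)
planes₃ =
    (1 , 10) ∷ (1 , 37) ∷ (1 , 72) ∷ (2 , 18) ∷ (2 , 39) ∷ (2 , 44) ∷ (3 , 11) ∷ (3 , 44) ∷
    (4 , 73) ∷ []

-- A 2-(7,3,c)₂ design has 2667 c / 7 = 381 c blocks, hence 3 c orbits of length 127, here 12. A
-- 2-(7,4,5c)₂ design has equally many.
planes₄ : List (ℕ × ℕ)
planes₄ =
    (1 , 3) ∷ (1 , 17) ∷ (1 , 23) ∷ (1 , 40) ∷ (2 , 11) ∷ (2 , 36) ∷ (3 , 26) ∷ (3 , 45) ∷ (4 , 8) ∷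
    (5 , 20) ∷ (5 , 25) ∷ (8 , 19) ∷ []

planes₅ : List (ℕ × ℕ)
planes₅ =
    (1 , 25) ∷ (1 , 26) ∷ (1 , 27) ∷ (1 , 34) ∷ (1 , 39) ∷ (2 , 17) ∷ (2 , 19) ∷ (2 , 35) ∷
    (2 , 52) ∷ (2 , 73) ∷ (3 , 16) ∷ (3 , 42) ∷ (4 , 37) ∷ (5 , 37) ∷ (10 , 21) ∷ []

planes₅′ : List (ℕ × ℕ)
planes₅′ =
    (1 , 4) ∷ (1 , 9) ∷ (1 , 22) ∷ (1 , 42) ∷ (1 , 81) ∷ (2 , 5) ∷ (2 , 22) ∷ (2 , 34) ∷ (3 , 22) ∷
    (4 , 17) ∷ (4 , 23) ∷ (5 , 32) ∷ (8 , 17) ∷ (8 , 23) ∷ (10 , 40) ∷ []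

solids₃ : List (ℕ × ℕ × ℕ)
solids₃ =
    (1 , 2 , 34) ∷ (1 , 3 , 42) ∷ (1 , 4 , 9) ∷ (1 , 4 , 23) ∷ (1 , 4 , 24) ∷ (1 , 5 , 40) ∷
    (1 , 9 , 11) ∷ (1 , 9 , 20) ∷ (1 , 24 , 45) ∷ []

solids₄ : List (ℕ × ℕ × ℕ)
solids₄ =
    (1 , 2 , 4) ∷ (1 , 2 , 17) ∷ (1 , 2 , 23) ∷ (1 , 3 , 11) ∷ (1 , 5 , 27) ∷ (1 , 9 , 24) ∷
    (1 , 9 , 26) ∷ (1 , 10 , 23) ∷ (1 , 11 , 20) ∷ (1 , 12 , 33) ∷ (1 , 12 , 42) ∷ (1 , 20 , 25) ∷ []

solids₅ : List (ℕ × ℕ × ℕ)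
solids₅ =
    (1 , 2 , 41) ∷ (1 , 3 , 20) ∷ (1 , 3 , 24) ∷ (1 , 4 , 17) ∷ (1 , 5 , 16) ∷ (1 , 5 , 20) ∷
    (1 , 9 , 12) ∷ (1 , 9 , 18) ∷ (1 , 9 , 34) ∷ (1 , 9 , 39) ∷ (1 , 11 , 22) ∷ (1 , 12 , 17) ∷
    (1 , 17 , 40) ∷ (1 , 18 , 23) ∷ (1 , 20 , 23) ∷ []

solids₅′ : List (ℕ × ℕ × ℕ)
solids₅′ =
    (1 , 2 , 10) ∷ (1 , 2 , 18) ∷ (1 , 3 , 4) ∷ (1 , 3 , 12) ∷ (1 , 5 , 22) ∷ (1 , 5 , 24) ∷
    (1 , 5 , 37) ∷ (1 , 9 , 10) ∷ (1 , 9 , 17) ∷ (1 , 11 , 16) ∷ (1 , 11 , 24) ∷ (1 , 17 , 25) ∷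
    (1 , 20 , 33) ∷ (1 , 23 , 27) ∷ (1 , 39 , 42) ∷ []

planes₂₂ : List (ℕ × ℕ)
planes₂₂ =
    (1 , 3) ∷ (1 , 23) ∷ (1 , 26) ∷ (1 , 31) ∷ (1 , 33) ∷ (1 , 47) ∷ (1 , 50) ∷ (1 , 58) ∷
    (1 , 66) ∷ (1 , 98) ∷ (1 , 106) ∷ (1 , 117) ∷ (1 , 124) ∷ (1 , 146) ∷ (1 , 157) ∷ (1 , 180) ∷
    (1 , 191) ∷ (1 , 204) ∷ (1 , 206) ∷ (1 , 222) ∷ (1 , 292) ∷ (2 , 35) ∷ (2 , 42) ∷ (2 , 44) ∷
    (2 , 48) ∷ (2 , 78) ∷ (2 , 81) ∷ (2 , 84) ∷ (2 , 91) ∷ (2 , 98) ∷ (2 , 100) ∷ (2 , 102) ∷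
    (2 , 113) ∷ (2 , 122) ∷ (2 , 124) ∷ (2 , 127) ∷ (2 , 172) ∷ (2 , 176) ∷ (2 , 206) ∷ (3 , 30) ∷
    (3 , 32) ∷ (3 , 33) ∷ (3 , 42) ∷ (3 , 73) ∷ (3 , 118) ∷ (3 , 120) ∷ (3 , 140) ∷ (3 , 159) ∷
    (3 , 165) ∷ (3 , 204) ∷ (3 , 282) ∷ (3 , 330) ∷ (4 , 23) ∷ (4 , 32) ∷ (4 , 39) ∷ (4 , 92) ∷
    (4 , 152) ∷ (4 , 209) ∷ (4 , 249) ∷ (4 , 295) ∷ (6 , 45) ∷ (6 , 49) ∷ (6 , 55) ∷ (6 , 63) ∷
    (6 , 155) ∷ (6 , 159) ∷ (6 , 176) ∷ (6 , 178) ∷ (6 , 273) ∷ (7 , 41) ∷ (7 , 82) ∷ (7 , 86) ∷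
    (7 , 95) ∷ (7 , 143) ∷ (7 , 157) ∷ (7 , 159) ∷ (7 , 303) ∷ (7 , 364) ∷ (11 , 79) ∷ (11 , 114) ∷
    (11 , 297) ∷ (12 , 162) ∷ (13 , 51) ∷ (14 , 99) ∷ (14 , 106) ∷ (14 , 113) ∷ (14 , 221) ∷
    (17 , 54) ∷ (17 , 172) ∷ (19 , 169) ∷ (23 , 106) ∷ (34 , 132) ∷ (39 , 172) ∷ (73 , 146) ∷ []

planes₂₁ : List (ℕ × ℕ)
planes₂₁ =
    (1 , 14) ∷ (1 , 21) ∷ (1 , 22) ∷ (1 , 39) ∷ (1 , 43) ∷ (1 , 51) ∷ (1 , 59) ∷ (1 , 63) ∷
    (1 , 69) ∷ (1 , 74) ∷ (1 , 89) ∷ (1 , 92) ∷ (1 , 128) ∷ (1 , 132) ∷ (1 , 153) ∷ (1 , 165) ∷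
    (1 , 169) ∷ (1 , 193) ∷ (1 , 212) ∷ (1 , 243) ∷ (1 , 287) ∷ (2 , 13) ∷ (2 , 19) ∷ (2 , 22) ∷
    (2 , 27) ∷ (2 , 39) ∷ (2 , 65) ∷ (2 , 76) ∷ (2 , 89) ∷ (2 , 93) ∷ (2 , 115) ∷ (2 , 141) ∷
    (2 , 166) ∷ (2 , 174) ∷ (2 , 191) ∷ (2 , 207) ∷ (2 , 245) ∷ (3 , 15) ∷ (3 , 28) ∷ (3 , 31) ∷
    (3 , 48) ∷ (3 , 68) ∷ (3 , 74) ∷ (3 , 86) ∷ (3 , 103) ∷ (3 , 185) ∷ (3 , 193) ∷ (3 , 196) ∷
    (4 , 35) ∷ (4 , 55) ∷ (4 , 57) ∷ (4 , 66) ∷ (4 , 74) ∷ (4 , 145) ∷ (4 , 149) ∷ (4 , 204) ∷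
    (4 , 296) ∷ (4 , 357) ∷ (6 , 12) ∷ (6 , 17) ∷ (6 , 29) ∷ (6 , 33) ∷ (6 , 39) ∷ (6 , 57) ∷
    (6 , 61) ∷ (6 , 96) ∷ (6 , 146) ∷ (6 , 152) ∷ (7 , 21) ∷ (7 , 45) ∷ (7 , 93) ∷ (7 , 102) ∷
    (7 , 120) ∷ (7 , 156) ∷ (11 , 55) ∷ (11 , 95) ∷ (11 , 97) ∷ (11 , 107) ∷ (11 , 233) ∷
    (12 , 35) ∷ (12 , 74) ∷ (12 , 97) ∷ (12 , 102) ∷ (13 , 177) ∷ (23 , 180) ∷ []

planes₂₁′ : List (ℕ × ℕ)
planes₂₁′ =
    (1 , 7) ∷ (1 , 11) ∷ (1 , 12) ∷ (1 , 24) ∷ (1 , 25) ∷ (1 , 27) ∷ (1 , 28) ∷ (1 , 40) ∷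
    (1 , 44) ∷ (1 , 48) ∷ (1 , 55) ∷ (1 , 76) ∷ (1 , 83) ∷ (1 , 84) ∷ (1 , 114) ∷ (1 , 123) ∷
    (1 , 136) ∷ (1 , 175) ∷ (1 , 211) ∷ (1 , 296) ∷ (2 , 4) ∷ (2 , 14) ∷ (2 , 31) ∷ (2 , 41) ∷
    (2 , 50) ∷ (2 , 63) ∷ (2 , 71) ∷ (2 , 73) ∷ (2 , 86) ∷ (2 , 90) ∷ (2 , 107) ∷ (2 , 148) ∷
    (2 , 159) ∷ (2 , 164) ∷ (2 , 293) ∷ (3 , 6) ∷ (3 , 41) ∷ (3 , 54) ∷ (3 , 57) ∷ (3 , 58) ∷
    (3 , 66) ∷ (3 , 90) ∷ (3 , 110) ∷ (3 , 149) ∷ (3 , 179) ∷ (3 , 207) ∷ (3 , 236) ∷ (4 , 37) ∷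
    (4 , 43) ∷ (4 , 44) ∷ (4 , 47) ∷ (4 , 53) ∷ (4 , 63) ∷ (4 , 83) ∷ (4 , 90) ∷ (4 , 99) ∷
    (4 , 159) ∷ (4 , 254) ∷ (6 , 25) ∷ (6 , 28) ∷ (6 , 34) ∷ (6 , 48) ∷ (6 , 60) ∷ (6 , 68) ∷
    (6 , 84) ∷ (6 , 280) ∷ (7 , 22) ∷ (7 , 114) ∷ (7 , 150) ∷ (11 , 33) ∷ (11 , 46) ∷ (11 , 61) ∷
    (11 , 118) ∷ (11 , 124) ∷ (11 , 133) ∷ (12 , 49) ∷ (12 , 58) ∷ (13 , 30) ∷ (13 , 152) ∷
    (13 , 168) ∷ (14 , 42) ∷ (14 , 89) ∷ (14 , 286) ∷ (19 , 141) ∷ (23 , 46) ∷ (26 , 115) ∷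
    (33 , 68) ∷ []

planes₂₁″ : List (ℕ × ℕ)
planes₂₁″ =
    (1 , 5) ∷ (1 , 30) ∷ (1 , 32) ∷ (1 , 34) ∷ (1 , 35) ∷ (1 , 42) ∷ (1 , 45) ∷ (1 , 46) ∷
    (1 , 75) ∷ (1 , 82) ∷ (1 , 86) ∷ (1 , 88) ∷ (1 , 91) ∷ (1 , 97) ∷ (1 , 100) ∷ (1 , 121) ∷
    (1 , 122) ∷ (1 , 176) ∷ (1 , 201) ∷ (2 , 6) ∷ (2 , 21) ∷ (2 , 26) ∷ (2 , 37) ∷ (2 , 43) ∷
    (2 , 46) ∷ (2 , 55) ∷ (2 , 68) ∷ (2 , 75) ∷ (2 , 92) ∷ (2 , 152) ∷ (2 , 170) ∷ (2 , 193) ∷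
    (2 , 203) ∷ (2 , 211) ∷ (2 , 267) ∷ (3 , 17) ∷ (3 , 22) ∷ (3 , 29) ∷ (3 , 45) ∷ (3 , 62) ∷
    (3 , 76) ∷ (3 , 85) ∷ (3 , 89) ∷ (3 , 98) ∷ (3 , 114) ∷ (3 , 177) ∷ (3 , 203) ∷ (3 , 233) ∷
    (4 , 46) ∷ (4 , 49) ∷ (4 , 51) ∷ (4 , 70) ∷ (4 , 82) ∷ (4 , 87) ∷ (4 , 88) ∷ (4 , 96) ∷
    (4 , 102) ∷ (4 , 131) ∷ (4 , 200) ∷ (6 , 37) ∷ (6 , 51) ∷ (6 , 87) ∷ (6 , 279) ∷ (7 , 33) ∷
    (7 , 46) ∷ (7 , 81) ∷ (7 , 90) ∷ (7 , 110) ∷ (7 , 206) ∷ (7 , 207) ∷ (11 , 82) ∷ (11 , 93) ∷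
    (11 , 96) ∷ (11 , 100) ∷ (11 , 111) ∷ (12 , 47) ∷ (12 , 50) ∷ (12 , 62) ∷ (12 , 66) ∷
    (12 , 164) ∷ (12 , 168) ∷ (12 , 174) ∷ (13 , 59) ∷ (13 , 110) ∷ (13 , 222) ∷ (14 , 44) ∷
    (17 , 66) ∷ (19 , 49) ∷ (21 , 70) ∷ (21 , 143) ∷ (23 , 93) ∷ (35 , 70) ∷ (35 , 133) ∷ []

solids₂₂ : List (ℕ × ℕ × ℕ)
solids₂₂ =
    (1 , 2 , 12) ∷ (1 , 2 , 17) ∷ (1 , 2 , 21) ∷ (1 , 2 , 22) ∷ (1 , 2 , 23) ∷ (1 , 2 , 28) ∷
    (1 , 2 , 43) ∷ (1 , 2 , 48) ∷ (1 , 2 , 55) ∷ (1 , 2 , 62) ∷ (1 , 2 , 86) ∷ (1 , 2 , 87) ∷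
    (1 , 2 , 89) ∷ (1 , 3 , 4) ∷ (1 , 3 , 16) ∷ (1 , 3 , 28) ∷ (1 , 3 , 41) ∷ (1 , 3 , 42) ∷
    (1 , 3 , 46) ∷ (1 , 3 , 51) ∷ (1 , 3 , 62) ∷ (1 , 3 , 69) ∷ (1 , 3 , 74) ∷ (1 , 3 , 178) ∷
    (1 , 4 , 7) ∷ (1 , 4 , 15) ∷ (1 , 4 , 31) ∷ (1 , 4 , 33) ∷ (1 , 4 , 48) ∷ (1 , 4 , 82) ∷
    (1 , 4 , 115) ∷ (1 , 4 , 122) ∷ (1 , 4 , 137) ∷ (1 , 4 , 178) ∷ (1 , 6 , 23) ∷ (1 , 6 , 25) ∷
    (1 , 6 , 41) ∷ (1 , 6 , 47) ∷ (1 , 6 , 191) ∷ (1 , 6 , 201) ∷ (1 , 7 , 29) ∷ (1 , 7 , 30) ∷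
    (1 , 7 , 41) ∷ (1 , 7 , 42) ∷ (1 , 7 , 58) ∷ (1 , 7 , 64) ∷ (1 , 7 , 69) ∷ (1 , 8 , 14) ∷
    (1 , 8 , 33) ∷ (1 , 8 , 96) ∷ (1 , 11 , 14) ∷ (1 , 11 , 42) ∷ (1 , 11 , 58) ∷ (1 , 11 , 81) ∷
    (1 , 11 , 86) ∷ (1 , 11 , 121) ∷ (1 , 12 , 13) ∷ (1 , 12 , 14) ∷ (1 , 12 , 43) ∷ (1 , 12 , 93) ∷
    (1 , 12 , 100) ∷ (1 , 12 , 212) ∷ (1 , 13 , 34) ∷ (1 , 13 , 100) ∷ (1 , 13 , 165) ∷
    (1 , 14 , 31) ∷ (1 , 14 , 107) ∷ (1 , 15 , 42) ∷ (1 , 15 , 43) ∷ (1 , 15 , 54) ∷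
    (1 , 15 , 165) ∷ (1 , 16 , 22) ∷ (1 , 16 , 24) ∷ (1 , 16 , 49) ∷ (1 , 16 , 51) ∷
    (1 , 16 , 153) ∷ (1 , 17 , 24) ∷ (1 , 17 , 25) ∷ (1 , 17 , 59) ∷ (1 , 17 , 116) ∷
    (1 , 17 , 123) ∷ (1 , 20 , 41) ∷ (1 , 20 , 42) ∷ (1 , 20 , 62) ∷ (1 , 20 , 89) ∷ (1 , 21 , 23) ∷
    (1 , 21 , 24) ∷ (1 , 21 , 118) ∷ (1 , 21 , 137) ∷ (1 , 21 , 153) ∷ (1 , 22 , 45) ∷
    (1 , 22 , 66) ∷ (1 , 23 , 85) ∷ (1 , 24 , 69) ∷ (1 , 24 , 86) ∷ (1 , 25 , 62) ∷ (1 , 26 , 51) ∷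
    (1 , 26 , 123) ∷ (1 , 27 , 98) ∷ (1 , 28 , 169) ∷ (1 , 28 , 178) ∷ (1 , 28 , 196) ∷
    (1 , 29 , 87) ∷ (1 , 29 , 157) ∷ (1 , 29 , 169) ∷ (1 , 30 , 49) ∷ (1 , 30 , 55) ∷
    (1 , 35 , 74) ∷ (1 , 38 , 84) ∷ (1 , 39 , 118) ∷ (1 , 42 , 199) ∷ (1 , 42 , 296) ∷
    (1 , 43 , 55) ∷ (1 , 47 , 115) ∷ (1 , 47 , 137) ∷ (1 , 48 , 193) ∷ (1 , 49 , 63) ∷
    (1 , 50 , 85) ∷ (1 , 59 , 107) ∷ (1 , 63 , 76) ∷ (1 , 74 , 123) ∷ (1 , 76 , 103) ∷
    (1 , 82 , 165) ∷ (3 , 6 , 88) ∷ (3 , 15 , 48) ∷ (3 , 15 , 50) ∷ (3 , 17 , 34) ∷ (3 , 28 , 31) ∷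
    (3 , 34 , 103) ∷ (3 , 42 , 140) ∷ []

solids₂₁ : List (ℕ × ℕ × ℕ)
solids₂₁ =
    (1 , 2 , 27) ∷ (1 , 2 , 34) ∷ (1 , 2 , 51) ∷ (1 , 2 , 59) ∷ (1 , 2 , 93) ∷ (1 , 2 , 124) ∷
    (1 , 2 , 137) ∷ (1 , 3 , 20) ∷ (1 , 3 , 29) ∷ (1 , 3 , 35) ∷ (1 , 3 , 40) ∷ (1 , 3 , 43) ∷
    (1 , 3 , 49) ∷ (1 , 3 , 76) ∷ (1 , 3 , 81) ∷ (1 , 3 , 83) ∷ (1 , 3 , 88) ∷ (1 , 3 , 116) ∷
    (1 , 3 , 128) ∷ (1 , 3 , 179) ∷ (1 , 4 , 43) ∷ (1 , 4 , 46) ∷ (1 , 4 , 51) ∷ (1 , 4 , 54) ∷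
    (1 , 4 , 62) ∷ (1 , 4 , 114) ∷ (1 , 4 , 169) ∷ (1 , 6 , 28) ∷ (1 , 6 , 40) ∷ (1 , 6 , 45) ∷
    (1 , 6 , 61) ∷ (1 , 6 , 76) ∷ (1 , 6 , 81) ∷ (1 , 6 , 88) ∷ (1 , 7 , 11) ∷ (1 , 7 , 15) ∷
    (1 , 7 , 51) ∷ (1 , 7 , 66) ∷ (1 , 7 , 91) ∷ (1 , 7 , 92) ∷ (1 , 7 , 97) ∷ (1 , 8 , 12) ∷
    (1 , 8 , 22) ∷ (1 , 8 , 43) ∷ (1 , 8 , 62) ∷ (1 , 8 , 87) ∷ (1 , 8 , 157) ∷ (1 , 11 , 13) ∷
    (1 , 11 , 30) ∷ (1 , 11 , 32) ∷ (1 , 11 , 34) ∷ (1 , 11 , 38) ∷ (1 , 11 , 59) ∷ (1 , 11 , 75) ∷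
    (1 , 11 , 82) ∷ (1 , 11 , 107) ∷ (1 , 11 , 296) ∷ (1 , 12 , 31) ∷ (1 , 12 , 39) ∷
    (1 , 12 , 47) ∷ (1 , 12 , 62) ∷ (1 , 12 , 66) ∷ (1 , 12 , 97) ∷ (1 , 13 , 16) ∷ (1 , 13 , 38) ∷
    (1 , 14 , 17) ∷ (1 , 14 , 45) ∷ (1 , 14 , 89) ∷ (1 , 15 , 22) ∷ (1 , 15 , 28) ∷ (1 , 15 , 222) ∷
    (1 , 16 , 91) ∷ (1 , 17 , 38) ∷ (1 , 17 , 75) ∷ (1 , 20 , 82) ∷ (1 , 21 , 45) ∷ (1 , 22 , 25) ∷
    (1 , 22 , 46) ∷ (1 , 22 , 54) ∷ (1 , 22 , 87) ∷ (1 , 23 , 61) ∷ (1 , 23 , 62) ∷ (1 , 23 , 84) ∷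
    (1 , 23 , 86) ∷ (1 , 24 , 27) ∷ (1 , 24 , 46) ∷ (1 , 24 , 85) ∷ (1 , 24 , 180) ∷
    (1 , 24 , 206) ∷ (1 , 25 , 29) ∷ (1 , 25 , 39) ∷ (1 , 26 , 63) ∷ (1 , 26 , 74) ∷ (1 , 27 , 49) ∷
    (1 , 27 , 92) ∷ (1 , 28 , 29) ∷ (1 , 28 , 43) ∷ (1 , 31 , 74) ∷ (1 , 34 , 55) ∷ (1 , 34 , 92) ∷
    (1 , 35 , 76) ∷ (1 , 35 , 124) ∷ (1 , 38 , 87) ∷ (1 , 38 , 88) ∷ (1 , 38 , 96) ∷
    (1 , 38 , 193) ∷ (1 , 39 , 55) ∷ (1 , 39 , 88) ∷ (1 , 42 , 122) ∷ (1 , 43 , 243) ∷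
    (1 , 44 , 74) ∷ (1 , 45 , 75) ∷ (1 , 48 , 96) ∷ (1 , 48 , 153) ∷ (1 , 54 , 153) ∷
    (1 , 59 , 82) ∷ (1 , 63 , 97) ∷ (1 , 69 , 75) ∷ (1 , 69 , 179) ∷ []

solids₂₁′ : List (ℕ × ℕ × ℕ)
solids₂₁′ =
    (1 , 2 , 4) ∷ (1 , 2 , 8) ∷ (1 , 2 , 26) ∷ (1 , 2 , 35) ∷ (1 , 2 , 44) ∷ (1 , 2 , 75) ∷
    (1 , 2 , 81) ∷ (1 , 2 , 157) ∷ (1 , 2 , 176) ∷ (1 , 2 , 196) ∷ (1 , 3 , 6) ∷ (1 , 3 , 15) ∷
    (1 , 3 , 22) ∷ (1 , 3 , 25) ∷ (1 , 3 , 27) ∷ (1 , 3 , 44) ∷ (1 , 3 , 47) ∷ (1 , 3 , 50) ∷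
    (1 , 3 , 85) ∷ (1 , 3 , 194) ∷ (1 , 4 , 50) ∷ (1 , 4 , 74) ∷ (1 , 4 , 87) ∷ (1 , 4 , 179) ∷
    (1 , 6 , 7) ∷ (1 , 6 , 8) ∷ (1 , 6 , 22) ∷ (1 , 6 , 27) ∷ (1 , 6 , 35) ∷ (1 , 6 , 84) ∷
    (1 , 7 , 22) ∷ (1 , 7 , 28) ∷ (1 , 7 , 33) ∷ (1 , 7 , 34) ∷ (1 , 7 , 88) ∷ (1 , 7 , 153) ∷
    (1 , 8 , 47) ∷ (1 , 8 , 59) ∷ (1 , 8 , 82) ∷ (1 , 8 , 118) ∷ (1 , 8 , 136) ∷ (1 , 11 , 35) ∷
    (1 , 11 , 46) ∷ (1 , 11 , 76) ∷ (1 , 12 , 34) ∷ (1 , 12 , 74) ∷ (1 , 12 , 91) ∷ (1 , 13 , 29) ∷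
    (1 , 13 , 47) ∷ (1 , 13 , 51) ∷ (1 , 13 , 123) ∷ (1 , 13 , 124) ∷ (1 , 14 , 20) ∷
    (1 , 14 , 22) ∷ (1 , 14 , 25) ∷ (1 , 14 , 44) ∷ (1 , 14 , 46) ∷ (1 , 14 , 55) ∷ (1 , 14 , 59) ∷
    (1 , 14 , 82) ∷ (1 , 15 , 23) ∷ (1 , 15 , 39) ∷ (1 , 15 , 41) ∷ (1 , 15 , 47) ∷ (1 , 15 , 59) ∷
    (1 , 15 , 74) ∷ (1 , 16 , 35) ∷ (1 , 16 , 38) ∷ (1 , 16 , 39) ∷ (1 , 16 , 69) ∷ (1 , 17 , 58) ∷
    (1 , 17 , 63) ∷ (1 , 17 , 74) ∷ (1 , 17 , 98) ∷ (1 , 17 , 222) ∷ (1 , 20 , 33) ∷ (1 , 20 , 39) ∷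
    (1 , 20 , 44) ∷ (1 , 20 , 59) ∷ (1 , 20 , 66) ∷ (1 , 20 , 115) ∷ (1 , 20 , 116) ∷
    (1 , 20 , 123) ∷ (1 , 21 , 25) ∷ (1 , 21 , 63) ∷ (1 , 22 , 24) ∷ (1 , 22 , 29) ∷ (1 , 22 , 92) ∷
    (1 , 22 , 98) ∷ (1 , 23 , 25) ∷ (1 , 23 , 30) ∷ (1 , 23 , 201) ∷ (1 , 24 , 61) ∷ (1 , 24 , 63) ∷
    (1 , 24 , 66) ∷ (1 , 24 , 97) ∷ (1 , 25 , 54) ∷ (1 , 25 , 75) ∷ (1 , 25 , 91) ∷ (1 , 25 , 98) ∷
    (1 , 26 , 222) ∷ (1 , 27 , 42) ∷ (1 , 28 , 62) ∷ (1 , 28 , 91) ∷ (1 , 29 , 228) ∷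
    (1 , 31 , 42) ∷ (1 , 31 , 48) ∷ (1 , 34 , 156) ∷ (1 , 35 , 49) ∷ (1 , 35 , 89) ∷ (1 , 38 , 54) ∷
    (1 , 38 , 107) ∷ (1 , 42 , 175) ∷ (1 , 43 , 84) ∷ (1 , 45 , 132) ∷ (1 , 48 , 76) ∷
    (1 , 62 , 92) ∷ (1 , 89 , 212) ∷ (1 , 124 , 136) ∷ []

solids₂₁″ : List (ℕ × ℕ × ℕ)
solids₂₁″ =
    (1 , 2 , 6) ∷ (1 , 2 , 14) ∷ (1 , 2 , 24) ∷ (1 , 2 , 25) ∷ (1 , 2 , 39) ∷ (1 , 2 , 41) ∷
    (1 , 2 , 47) ∷ (1 , 2 , 82) ∷ (1 , 2 , 116) ∷ (1 , 3 , 7) ∷ (1 , 3 , 23) ∷ (1 , 3 , 45) ∷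
    (1 , 3 , 58) ∷ (1 , 3 , 64) ∷ (1 , 3 , 66) ∷ (1 , 3 , 103) ∷ (1 , 3 , 123) ∷ (1 , 4 , 30) ∷
    (1 , 4 , 32) ∷ (1 , 4 , 38) ∷ (1 , 4 , 44) ∷ (1 , 4 , 49) ∷ (1 , 4 , 84) ∷ (1 , 4 , 88) ∷
    (1 , 4 , 89) ∷ (1 , 4 , 92) ∷ (1 , 4 , 100) ∷ (1 , 4 , 124) ∷ (1 , 6 , 12) ∷ (1 , 6 , 20) ∷
    (1 , 6 , 38) ∷ (1 , 6 , 51) ∷ (1 , 6 , 63) ∷ (1 , 6 , 87) ∷ (1 , 6 , 137) ∷ (1 , 7 , 8) ∷
    (1 , 7 , 21) ∷ (1 , 7 , 24) ∷ (1 , 7 , 26) ∷ (1 , 7 , 31) ∷ (1 , 7 , 32) ∷ (1 , 7 , 35) ∷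
    (1 , 7 , 55) ∷ (1 , 7 , 82) ∷ (1 , 7 , 106) ∷ (1 , 7 , 124) ∷ (1 , 8 , 21) ∷ (1 , 8 , 30) ∷
    (1 , 8 , 81) ∷ (1 , 11 , 22) ∷ (1 , 11 , 23) ∷ (1 , 11 , 66) ∷ (1 , 11 , 85) ∷ (1 , 11 , 92) ∷
    (1 , 11 , 98) ∷ (1 , 11 , 114) ∷ (1 , 11 , 157) ∷ (1 , 12 , 26) ∷ (1 , 12 , 35) ∷
    (1 , 12 , 98) ∷ (1 , 13 , 24) ∷ (1 , 13 , 35) ∷ (1 , 13 , 59) ∷ (1 , 13 , 82) ∷ (1 , 14 , 42) ∷
    (1 , 14 , 58) ∷ (1 , 14 , 62) ∷ (1 , 14 , 100) ∷ (1 , 14 , 180) ∷ (1 , 15 , 21) ∷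
    (1 , 16 , 28) ∷ (1 , 16 , 30) ∷ (1 , 16 , 40) ∷ (1 , 16 , 55) ∷ (1 , 16 , 59) ∷ (1 , 16 , 169) ∷
    (1 , 16 , 193) ∷ (1 , 17 , 29) ∷ (1 , 17 , 40) ∷ (1 , 17 , 50) ∷ (1 , 17 , 194) ∷
    (1 , 20 , 54) ∷ (1 , 20 , 106) ∷ (1 , 21 , 28) ∷ (1 , 21 , 34) ∷ (1 , 22 , 34) ∷ (1 , 22 , 55) ∷
    (1 , 22 , 121) ∷ (1 , 22 , 122) ∷ (1 , 23 , 46) ∷ (1 , 23 , 93) ∷ (1 , 25 , 44) ∷
    (1 , 26 , 39) ∷ (1 , 27 , 75) ∷ (1 , 27 , 93) ∷ (1 , 28 , 42) ∷ (1 , 28 , 47) ∷ (1 , 28 , 51) ∷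
    (1 , 29 , 43) ∷ (1 , 29 , 59) ∷ (1 , 29 , 115) ∷ (1 , 34 , 48) ∷ (1 , 34 , 61) ∷
    (1 , 34 , 115) ∷ (1 , 38 , 93) ∷ (1 , 42 , 169) ∷ (1 , 44 , 114) ∷ (1 , 46 , 96) ∷
    (1 , 47 , 74) ∷ (1 , 47 , 82) ∷ (1 , 47 , 118) ∷ (1 , 48 , 124) ∷ (1 , 49 , 115) ∷
    (1 , 51 , 75) ∷ (1 , 55 , 82) ∷ (1 , 62 , 84) ∷ (1 , 63 , 82) ∷ (1 , 85 , 176) ∷ (3 , 31 , 88) ∷ []

-- Assembly of the designs

module _ (c l : ℕ) (P : List (ℕ × ℕ)) (S : List (ℕ × ℕ × ℕ)) where

  -- Planes and solids of GF(2)^7 have codimensions 4 and 3, and a plane has 16 cosets. The point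
  -- count is tested against `l` itself, which makes the equation for crossing lines `refl`.
  design₈ : GF128.PointCheck 4 l (map plane P) →
            GF128.LineCheck 4 c GF128.transversal (map plane P) →
            GF128.LineCheck 3 (5 * c) GF128.transversal (map solid S) →
            5 * c + 16 * c ≡ l → SubspaceDesign 2 8 4 l
  design₈ point✓ plane✓ solid✓ = Extension.design (Orbits (map plane P)) (Orbits (map solid S))
    (points (map plane P) {4} {l} point✓)
    (lines (map plane P) transversal {4} {c} transversal✓ plane✓)
    (lines (map solid S) transversal {3} {5 * c} transversal✓ solid✓)
    refl
    where open GF128

  -- The planes and the solids may be invariant under different groups, as the extension refers only
  -- to their counts.
  design₁₀ : GF512₈.PointCheck 6 l (map plane P) →
             GF512₈.LineCheck 6 c GF512₈.transversal (map plane P) →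
             GF512₂.LineCheck 5 (21 * c) GF512₂.transversal (map solid S) →
             21 * c + 64 * c ≡ l → SubspaceDesign 2 10 4 l
  design₁₀ point✓ plane✓ solid✓ = Extension.design
    (GF512₈.Orbits (map plane P)) (GF512₂.Orbits (map solid S))
    (GF512₈.points (map plane P) {6} {l} point✓)
    (GF512₈.lines (map plane P) GF512₈.transversal {6} {c} GF512₈.transversal✓ plane✓)
    (GF512₂.lines (map solid S) GF512₂.transversal {5} {21 * c} GF512₂.transversal✓ solid✓)
    refl

corollary17 : (∀ l → l ∈ (63 ∷ 84 ∷ 147 ∷ 168 ∷ 189 ∷ 252 ∷ 273 ∷ 294 ∷ []) → SubspaceDesign 2 8 4 l) ×
    (∀ l → l ∈ (1785 ∷ 1870 ∷ 3570 ∷ 3655 ∷ 5355 ∷ []) → SubspaceDesign 2 10 4 l)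
corollary17 = eight , ten
  where
  eight : ∀ l → l ∈ (63 ∷ 84 ∷ 147 ∷ 168 ∷ 189 ∷ 252 ∷ 273 ∷ 294 ∷ []) → SubspaceDesign 2 8 4 l
  eight l (here refl) = design₈ 3 l planes₃ solids₃ refl refl refl refl
  eight l (there (here refl)) = design₈ 4 l planes₄ solids₄ refl refl refl refl
  eight l (there (there (here refl))) = design₈ 7 l (planes₃ ++ planes₄) (solids₃ ++ solids₄) refl refl refl refl
  eight l (there (there (there (here refl)))) = design₈ 8 l (planes₃ ++ planes₅) (solids₃ ++ solids₅) refl refl refl refl
  eight l (there (there (there (there (here refl))))) = design₈ 9 l (planes₄ ++ planes₅) (solids₄ ++ solids₅) refl refl refl refl
  eight l (there (there (there (there (there (here refl)))))) =
    design₈ 12 l (planes₃ ++ planes₄ ++ planes₅) (solids₃ ++ solids₄ ++ solids₅) refl refl refl refl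
  eight l (there (there (there (there (there (there (here refl))))))) =
    design₈ 13 l (planes₃ ++ planes₅ ++ planes₅′) (solids₃ ++ solids₅ ++ solids₅′) refl refl refl refl
  eight l (there (there (there (there (there (there (there (here refl)))))))) =
    design₈ 14 l (planes₄ ++ planes₅ ++ planes₅′) (solids₄ ++ solids₅ ++ solids₅′) refl refl refl refl

  ten : ∀ l → l ∈ (1785 ∷ 1870 ∷ 3570 ∷ 3655 ∷ 5355 ∷ []) → SubspaceDesign 2 10 4 l
  ten l (here refl) = design₁₀ 21 l planes₂₁ solids₂₁ refl refl refl refl
  ten l (there (here refl)) = design₁₀ 22 l planes₂₂ solids₂₂ refl refl refl refl
  ten l (there (there (here refl))) = design₁₀ 42 l (planes₂₁ ++ planes₂₁′) (solids₂₁ ++ solids₂₁′) refl refl refl refl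
  ten l (there (there (there (here refl)))) = design₁₀ 43 l (planes₂₁ ++ planes₂₂) (solids₂₁ ++ solids₂₂) refl refl refl refl
  ten l (there (there (there (there (here refl))))) =
    design₁₀ 63 l (planes₂₁ ++ planes₂₁′ ++ planes₂₁″) (solids₂₁ ++ solids₂₁′ ++ solids₂₁″) refl refl refl refl
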